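{- Let $G$ be a finite graph and $\mathcal{IS}(G)$ the set of independent sets of $G$. If $G$ is connected, then $\mathcal{IS}(G)$ is toggle-alternating. If $G$ has components $G_1,G_2,\ldots,G_k$, then $T(\mathcal{IS}(G))\cong T(\mathcal{IS}(G_1))\times T(\mathcal{IS}(G_2))\times\cdots\times T(\mathcal{IS}(G_k))$.
   Context: An independent set in a graph $G$ is a subset of the vertices such that no two have an edge between them. $\mathcal{IS}(G)\subseteq 2^{V(G)}$, with ground set the vertex set $V(G)$. For a finite set $E$ and $\mathcal{L}\subseteq 2^E$, the toggle of $e\in E$ is the map $t_e:\mathcal{L}\to\mathcal{L}$ with $t_e(X)=X\cup\{e\}$ if $e\notin X$ and $X\cup\{e\}\in\mathcal{L}$; $t_e(X)=X\setminus\{e\}$ if $e\in X$ and $X\setminus\{e\}\in\mathcal{L}$; and $t_e(X)=X$ otherwise. The toggle group $T(\mathcal{L})$ is the subgroup of the symmetric group $\mathfrak{S}_{\mathcal{L}}$ generated by $\{t_e\mid e\in E\}$. $\mathcal{L}$ is toggle-alternating if $T(\mathcal{L})$ contains the alternating group $A_{\mathcal{L}}$. -}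

module Defs where

open import Algebra.Bundles using (Group)
open import Algebra.Construct.DirectProduct using () renaming (group to _×ᴳ_)
open import Algebra.Construct.Terminal using () renaming (group to 𝟙)
open import Algebra.Morphism.Structures using (IsGroupIsomorphism)
open import Data.Fin using (Fin; zero; suc)
open import Data.Fin.Properties using (all?)
open import Data.Fin.Subset using (Subset; inside; outside; _∈_; _∉_; _⊆_; _∪_; _∩_; _-_; ⁅_⁆)
open import Data.Fin.Subset.Properties using (_∈?_; _⊆?_; p─⊥≡p; ∪-identityʳ; x∈p∪q⁺; x∈p∩q⁺; x∈⁅x⁆)
open import Data.Irrelevant using ([_])
open import Data.List using (foldr; length)
open import Data.List.Relation.Unary.All using (All)
open import Data.Nat using (ℕ)
open import Data.Nat.Divisibility using (_∣_)
open import Data.Product using (∃; ∃-syntax; _×_; _,_; proj₁)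
open import Data.Refinement using (Refinement; _,_; value-injective)
open import Data.Sum using (_⊎_; inj₁; inj₂)
open import Data.Vec using (_∷_; here; there)
import Data.Vec.Functional as Vector
open import Function using (_∘_; _↔_; mk↔ₛ′; Inverse; _⇔_; Injective)
open import Function.Construct.Composition using (_↔-∘_)
open import Function.Construct.Identity using (↔-id)
open import Function.Construct.Symmetry using (↔-sym)
open import Level using (Level; 0ℓ; _⊔_)
open import Relation.Binary using (Rel; Irreflexive; Symmetric; Decidable)
open import Relation.Binary.Construct.Closure.ReflexiveTransitive using (Star)
open import Relation.Binary.PropositionalEquality using (_≡_; _≢_; refl; sym; trans; cong; subst)
open import Relation.Nullary using (¬_; yes; no; contradiction; contradiction-irr)
open import Relation.Nullary.Decidable using (_×-dec_; _→-dec_; ¬?)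
import Relation.Unary as Unary

private
  variable
    c ℓ c′ ℓ′ i : Level
    k n : ℕ

module _ (G : Group c ℓ) {I : Set i} (gen : I → Group.Carrier G) where
  private module G = Group G
  open G using (Carrier; _≈_; _∙_; ε; _⁻¹)

  data GeneratedBy : Carrier → Set (c ⊔ ℓ ⊔ i) where
    generator : ∀ j → GeneratedBy (gen j)
    identity  : GeneratedBy ε
    product   : ∀ {x y} → GeneratedBy x → GeneratedBy y → GeneratedBy (x ∙ y)
    inverse   : ∀ {x} → GeneratedBy x → GeneratedBy (x ⁻¹)
    respects  : ∀ {x y} → x ≈ y → GeneratedBy x → GeneratedBy y

  generatedSubgroup : Group (c ⊔ ℓ ⊔ i) ℓ
  generatedSubgroup = record
    { Carrier = ∃ GeneratedBy
    ; _≈_     = λ x y → proj₁ x ≈ proj₁ y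
    ; _∙_     = λ (x , p) (y , q) → x ∙ y , product p q
    ; ε       = ε , identity
    ; _⁻¹     = λ (x , p) → x ⁻¹ , inverse p
    ; isGroup = record
      { isMonoid = record
        { isSemigroup = record
          { isMagma = record
            { isEquivalence = record
              { refl = G.refl ; sym = G.sym ; trans = G.trans }
            ; ∙-cong = G.∙-cong
            }
          ; assoc = λ x y z → G.assoc (proj₁ x) (proj₁ y) (proj₁ z)
          }
        ; identity = (λ x → G.identityˡ (proj₁ x)) , (λ x → G.identityʳ (proj₁ x))
        }
      ; inverse = (λ x → G.inverseˡ (proj₁ x)) , (λ x → G.inverseʳ (proj₁ x))
      ; ⁻¹-cong = G.⁻¹-cong
      }
    }

infix 4 _≅_

_≅_ : Group c ℓ → Group c′ ℓ′ → Set (c ⊔ ℓ ⊔ c′ ⊔ ℓ′)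
G ≅ H = ∃ (IsGroupIsomorphism (Group.rawGroup G) (Group.rawGroup H))

∏ : (Fin k → Group c ℓ) → Group c ℓ
∏ = Vector.foldr _×ᴳ_ 𝟙

-- Multiplication is composition of functions: (π ∙ ρ) x = π (ρ x).
𝔖 : Set → Group 0ℓ 0ℓ
𝔖 A = record
  { Carrier = A ↔ A
  ; _≈_     = λ π ρ → ∀ x → Inverse.to π x ≡ Inverse.to ρ x
  ; _∙_     = _↔-∘_
  ; ε       = ↔-id A
  ; _⁻¹     = ↔-sym
  ; isGroup = record
    { isMonoid = record
      { isSemigroup = record
        { isMagma = record
          { isEquivalence = record
            { refl  = λ _ → refl
            ; sym   = λ p x → sym (p x)
            ; trans = λ p q x → trans (p x) (q x)
            }
          ; ∙-cong = λ {_} {π} p q x → trans (p _) (cong (Inverse.to π) (q x))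
          }
        ; assoc = λ _ _ _ _ → refl
        }
      ; identity = (λ _ _ → refl) , (λ _ _ → refl)
      }
    ; inverse = (λ π x → Inverse.strictlyInverseʳ π x)
              , (λ π x → Inverse.strictlyInverseˡ π x)
    ; ⁻¹-cong = λ {π} {ρ} p x →
        trans (sym (Inverse.strictlyInverseʳ ρ _))
              (cong (Inverse.from ρ)
                    (trans (sym (p _)) (Inverse.strictlyInverseˡ π x)))
    }
  }

IsTransposition : {A : Set} → A ↔ A → Set
IsTransposition τ = ∃[ x ] ∃[ y ]
    x ≢ y
  × Inverse.to τ x ≡ y
  × Inverse.to τ y ≡ x
  × (∀ z → z ≢ x → z ≢ y → Inverse.to τ z ≡ z)

-- The even permutations are the elements of the alternating group on A.
IsEven : {A : Set} → A ↔ A → Set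
IsEven {A} π = ∃[ τs ] All IsTransposition τs × 2 ∣ length τs × π ≈ foldr _∙_ ε τs
  where open Group (𝔖 A)

-- A finite ground set E together with 𝓛 ⊆ 2^E.  So that one type of
-- subsets serves all ground sets under consideration (such as the vertex
-- sets of a graph and of its components), E is a subset of an ambient
-- Fin n.
record SetFamily (n : ℕ) : Set₁ where
  field
    E   : Subset n
    𝓛   : Subset n → Set
    𝓛?  : Unary.Decidable 𝓛
    𝓛⊆E : ∀ {X} → 𝓛 X → X ⊆ E

-- The membership proof is irrelevant, so two members are equal as soon
-- as their underlying subsets are.
Member : SetFamily n → Set
Member {n} F = Refinement (Subset n) (SetFamily.𝓛 F)

private
  ∪-then-remove : ∀ (X : Subset n) e → e ∉ X → (X ∪ ⁅ e ⁆) - e ≡ X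
  ∪-then-remove (inside  ∷ X) zero    e∉X = contradiction here e∉X
  ∪-then-remove (outside ∷ X) zero    _   =
    cong (outside ∷_) (trans (p─⊥≡p _) (∪-identityʳ X))
  ∪-then-remove (inside  ∷ X) (suc e) e∉X = cong (inside ∷_) (∪-then-remove X e (e∉X ∘ there))
  ∪-then-remove (outside ∷ X) (suc e) e∉X = cong (outside ∷_) (∪-then-remove X e (e∉X ∘ there))

  remove-then-∪ : ∀ (X : Subset n) e → e ∈ X → (X - e) ∪ ⁅ e ⁆ ≡ X
  remove-then-∪ (inside  ∷ X) zero    here        =
    cong (inside ∷_) (trans (∪-identityʳ _) (p─⊥≡p X))
  remove-then-∪ (inside  ∷ X) (suc e) (there e∈X) = cong (inside ∷_) (remove-then-∪ X e e∈X)
  remove-then-∪ (outside ∷ X) (suc e) (there e∈X) = cong (outside ∷_) (remove-then-∪ X e e∈X)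

  e∉X-e : ∀ (X : Subset n) e → e ∉ (X - e)
  e∉X-e (_ ∷ X) (suc e) (there e∈) = e∉X-e X e e∈

module _ (F : SetFamily n) where
  open SetFamily F

  toggleMap : Fin n → Member F → Member F
  toggleMap e (X , p) with e ∈? X
  ... | no _ with 𝓛? (X ∪ ⁅ e ⁆)
  ...   | yes q = X ∪ ⁅ e ⁆ , [ q ]
  ...   | no _  = X , p
  toggleMap e (X , p) | yes _ with 𝓛? (X - e)
  ...   | yes q = X - e , [ q ]
  ...   | no _  = X , p

  private
    insertion : ∀ e {X p} → e ∉ X → .(q : 𝓛 (X ∪ ⁅ e ⁆)) →
                toggleMap e (X , p) ≡ (X ∪ ⁅ e ⁆ , [ q ])
    insertion e {X} e∉X q with e ∈? X
    ... | yes e∈X = contradiction e∈X e∉X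
    ... | no _ with 𝓛? (X ∪ ⁅ e ⁆)
    ...   | yes _ = refl
    ...   | no ¬q = contradiction-irr q ¬q

    deletion : ∀ e {X p} → e ∈ X → .(q : 𝓛 (X - e)) →
               toggleMap e (X , p) ≡ (X - e , [ q ])
    deletion e {X} e∈X q with e ∈? X
    ... | no e∉X = contradiction e∈X e∉X
    ... | yes _ with 𝓛? (X - e)
    ...   | yes _ = refl
    ...   | no ¬q = contradiction-irr q ¬q

    cases : ∀ e X {p} → (e ∉ X × 𝓛 (X ∪ ⁅ e ⁆)) ⊎ (e ∈ X × 𝓛 (X - e)) ⊎
            toggleMap e (X , p) ≡ (X , p)
    cases e X with e ∈? X
    ... | no e∉X with 𝓛? (X ∪ ⁅ e ⁆)
    ...   | yes q = inj₁ (e∉X , q)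
    ...   | no _  = inj₂ (inj₂ refl)
    cases e X | yes e∈X with 𝓛? (X - e)
    ...   | yes q = inj₂ (inj₁ (e∈X , q))
    ...   | no _  = inj₂ (inj₂ refl)

  toggleMap-involutive : ∀ e x → toggleMap e (toggleMap e x) ≡ x
  toggleMap-involutive e (X , [ p ]) with cases e X {[ p ]}
  ... | inj₁ (e∉X , q) = trans (cong (toggleMap e) (insertion e e∉X q))
    (trans (deletion e (x∈p∪q⁺ (inj₂ (x∈⁅x⁆ e))) (subst 𝓛 (sym eq) p)) (value-injective eq))
    where eq = ∪-then-remove X e e∉X
  ... | inj₂ (inj₁ (e∈X , q)) = trans (cong (toggleMap e) (deletion e e∈X q))
    (trans (insertion e (e∉X-e X e) (subst 𝓛 (sym eq) p)) (value-injective eq))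
    where eq = remove-then-∪ X e e∈X
  ... | inj₂ (inj₂ fixed) = trans (cong (toggleMap e) fixed) fixed

  toggle : ∃ (_∈ E) → Member F ↔ Member F
  toggle (e , _) = mk↔ₛ′ (toggleMap e) (toggleMap e)
    (toggleMap-involutive e) (toggleMap-involutive e)

  ToggleGroup : Group 0ℓ 0ℓ
  ToggleGroup = generatedSubgroup (𝔖 (Member F)) toggle

  ToggleAlternating : Set
  ToggleAlternating = ∀ π → IsEven π → GeneratedBy (𝔖 (Member F)) toggle π

-- A finite simple graph, whose vertex set is a subset of an ambient Fin n.
record Graph (n : ℕ) : Set₁ where
  infix 4 _~_ _~?_
  field
    V        : Subset n
    _~_      : Rel (Fin n) 0ℓ
    _~?_     : Decidable _~_
    ~-sym    : Symmetric _~_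
    ~-irrefl : Irreflexive _≡_ _~_
    ~⇒∈V     : ∀ {u v} → u ~ v → u ∈ V

module _ (G : Graph n) where
  open Graph G

  Independent : Subset n → Set
  Independent X = X ⊆ V × (∀ u v → u ∈ X → v ∈ X → ¬ u ~ v)

  independent? : Unary.Decidable Independent
  independent? X = X ⊆? V ×-dec
    all? λ u → all? λ v → u ∈? X →-dec v ∈? X →-dec ¬? (u ~? v)

  IS : SetFamily n
  IS = record { E = V ; 𝓛 = Independent ; 𝓛? = independent? ; 𝓛⊆E = proj₁ }

  -- The empty graph counts as connected, and as having no components.
  Connected : Set
  Connected = ∀ {u v} → u ∈ V → v ∈ V → Star _~_ u v

  -- The vertex sets of the components are the classes of the vertices
  -- under reachability.
  IsComponent : Subset n → Set
  IsComponent S = ∃[ v ] v ∈ V × (∀ w → w ∈ S ⇔ Star _~_ v w)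

  -- C lists the vertex sets of all components, each exactly once: the
  -- components partition V, so a list covering V omits none.
  AreComponents : (Fin k → Subset n) → Set
  AreComponents C =
      (∀ i → IsComponent (C i))
    × Injective _≡_ _≡_ C
    × (∀ {v} → v ∈ V → ∃[ i ] v ∈ C i)

  induced : Subset n → Graph n
  induced S = record
    { V        = V ∩ S
    ; _~_      = λ u v → u ∈ S × v ∈ S × u ~ v
    ; _~?_     = λ u v → u ∈? S ×-dec v ∈? S ×-dec u ~? v
    ; ~-sym    = λ (u∈S , v∈S , u~v) → v∈S , u∈S , ~-sym u~v
    ; ~-irrefl = λ u≡v (_ , _ , u~v) → ~-irrefl u≡v u~v
    ; ~⇒∈V     = λ (u∈S , _ , u~v) → x∈p∩q⁺ (~⇒∈V u~v , u∈S)
    }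

{-# OPTIONS --safe #-}
module Submission where

-- For G connected, write x ≋ y if x = y or some 3-cycle (x y z) lies in the toggle
-- group.  This is an equivalence relation preserved by the toggle group, and
-- connectedness forces it to be total as soon as ∅ ≋ {w} for one vertex w; so one
-- 3-cycle through ∅ and a singleton yields all 3-cycles.  Such a 3-cycle is found by
-- growing a connected vertex set U from an edge ab, for which it is t_a t_b.  If v ∉ U
-- is adjacent to w ∈ U, take a product π of toggles in U that permutes the independent
-- subsets of U as (∅ {w} {u}) with u ~ w.  Then t_w π t_w π⁻¹ is a 3-cycle on the
-- independent subsets of U ∪ {v}: on those avoiding v, conjugation by t_w inverts π,
-- which leaves π⁻² = π, and on those containing v, t_w is trivial.
--
-- In general, a toggle at a vertex of a component Cᵢ changes only the trace on Cᵢ, and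
-- acts on it as in the subgraph induced on Cᵢ, so that sending a permutation to its
-- actions on the traces gives the isomorphism.

open import Defs
open import Algebra.Bundles using (Group)
open import Algebra.Morphism.Structures using (IsGroupHomomorphism)
open import Data.Bool using () renaming (_≟_ to _≟ᴮ_)
import Data.Empty as Empty
open import Data.Fin using (Fin; zero; suc; _≟_)
open import Data.Fin.Properties using (any?; suc-injective)
open import Data.Fin.Subset using (Subset; Nonempty; ⊥; ∣_∣; _∈_; _∉_; _⊆_; _∪_; _∩_; _-_; ⁅_⁆)
open import Data.Fin.Subset.Properties
open import Data.Irrelevant using ([_])
open import Data.List using (List; []; _∷_; foldr; length; allFin)
open import Data.List.Membership.Propositional using () renaming (_∈_ to _∈ᴸ_)
open import Data.List.Membership.Propositional.Properties using (∈-allFin)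
open import Data.List.Relation.Unary.All using (All; []; _∷_)
open import Data.List.Relation.Unary.Any using (here; there)
open import Data.Nat using (ℕ; zero; suc; _<_; s≤s⁻¹)
open import Data.Nat.Divisibility using (_∣_; ∣m+n∣m⇒∣n; ∣1⇒≡1; ∣-refl)
open import Data.Nat.Properties using (<-trans; <-≤-trans; ≤-refl)
open import Data.Product using (∃; ∃-syntax; _×_; _,_; proj₁; proj₂)
import Data.Refinement as Refinement
open import Data.Refinement using (_,_; value; value-injective)
import Data.Sum as Sum
open import Data.Sum using (_⊎_; inj₁; inj₂; [_,_]′)
open import Data.Unit.Polymorphic using (tt)
open import Data.Vec using (_∷_; there)
open import Data.Vec.Properties using (≡-dec)
open import Function using (_∘_; id; _↔_; mk↔ₛ′; Inverse; _⇔_; mk⇔; Equivalence)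
open import Function.Properties.Equivalence using ()
  renaming (refl to ⇔-refl; sym to ⇔-sym; trans to ⇔-trans)
open import Level using (Level; _⊔_)
open import Relation.Binary using (DecidableEquality)
open import Relation.Binary.Construct.Closure.ReflexiveTransitive 
  using (Star; _◅_; _◅◅_) renaming (ε to ε⋆)
import Relation.Binary.Construct.Closure.ReflexiveTransitive as Star
open import Relation.Binary.PropositionalEquality
  using (_≡_; _≢_; refl; sym; trans; cong; subst; subst₂; ≢-sym)
open import Relation.Nullary
  using (Dec; ¬_; yes; no; contradiction; recompute; ¬?; _×-dec_; decidable-stable)

open Inverse using (to; from; strictlyInverseˡ; strictlyInverseʳ)
open Equivalence using () renaming (to to ⇒; from to ⇐)
open SetFamily

private
  variable
    a b c ℓ : Level
    k n : ℕ

-- 3-cycles in permutation groups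

module _ {A : Set} where
  open Group (𝔖 A) using (_∙_; _⁻¹)

  to-injective : (π : A ↔ A) {x y : A} → to π x ≡ to π y → x ≡ y
  to-injective π {x} {y} eq =
    trans (sym (strictlyInverseʳ π x)) (trans (cong (from π) eq) (strictlyInverseʳ π y))

  to⇒from : (π : A ↔ A) {x y : A} → to π x ≡ y → from π y ≡ x
  to⇒from π {x} eq = trans (cong (from π) (sym eq)) (strictlyInverseʳ π x)

  record Is3Cycle (π : A ↔ A) (x y z : A) : Set where
    field
      x≢y   : x ≢ y
      y≢z   : y ≢ z
      z≢x   : z ≢ x
      x↦y   : to π x ≡ y
      y↦z   : to π y ≡ z
      z↦x   : to π z ≡ x
      fixes : ∀ a → a ≢ x → a ≢ y → a ≢ z → to π a ≡ a

  open Is3Cycle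

  Is3Cycle-rotate : ∀ {π x y z} → Is3Cycle π x y z → Is3Cycle π y z x
  Is3Cycle-rotate c = record
    { x≢y = y≢z c ; y≢z = z≢x c ; z≢x = x≢y c
    ; x↦y = y↦z c ; y↦z = z↦x c ; z↦x = x↦y c
    ; fixes = λ a a≢y a≢z a≢x → fixes c a a≢x a≢y a≢z
    }

  Is3Cycle-invert : ∀ {π x y z} → Is3Cycle π x y z → Is3Cycle (π ⁻¹) y x z
  Is3Cycle-invert {π} c = record
    { x≢y = ≢-sym (x≢y c) ; y≢z = ≢-sym (z≢x c) ; z≢x = ≢-sym (y≢z c)
    ; x↦y = to⇒from π (x↦y c) ; y↦z = to⇒from π (z↦x c) ; z↦x = to⇒from π (y↦z c)
    ; fixes = λ a a≢y a≢x a≢z → to⇒from π (fixes c a a≢x a≢y a≢z)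
    }

  Is3Cycle-conjugate : ∀ {π x y z} (ρ : A ↔ A) → Is3Cycle π x y z →
                       Is3Cycle (ρ ∙ (π ∙ ρ ⁻¹)) (to ρ x) (to ρ y) (to ρ z)
  Is3Cycle-conjugate {π} ρ c = record
    { x≢y = x≢y c ∘ to-injective ρ
    ; y≢z = y≢z c ∘ to-injective ρ
    ; z≢x = z≢x c ∘ to-injective ρ
    ; x↦y = move (x↦y c) ; y↦z = move (y↦z c) ; z↦x = move (z↦x c)
    ; fixes = λ a a≢x a≢y a≢z →
        trans (cong (to ρ) (fixes c (from ρ a) (a≢x ∘ back) (a≢y ∘ back) (a≢z ∘ back)))
              (strictlyInverseˡ ρ a)
    }
    where
    move : ∀ {u v} → to π u ≡ v → to ρ (to π (from ρ (to ρ u))) ≡ to ρ v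
    move {u} eq = cong (to ρ) (trans (cong (to π) (strictlyInverseʳ ρ u)) eq)
    back : ∀ {a u} → from ρ a ≡ u → a ≡ to ρ u
    back {a} eq = trans (sym (strictlyInverseˡ ρ a)) (cong (to ρ) eq)

module _ {A I : Set} (gen : I → A ↔ A) where
  open Group (𝔖 A) using (_⁻¹)

  private
    ⟨gen⟩ : A ↔ A → Set
    ⟨gen⟩ = GeneratedBy (𝔖 A) gen

  Has3Cycle : A → A → A → Set
  Has3Cycle x y z = ∃[ π ] ⟨gen⟩ π × Is3Cycle π x y z

  infix 4 _≋_

  _≋_ : A → A → Set
  x ≋ y = x ≡ y ⊎ ∃ (Has3Cycle x y)

  Has3Cycle-rotate : ∀ {x y z} → Has3Cycle x y z → Has3Cycle y z x
  Has3Cycle-rotate (π , p , c) = π , p , Is3Cycle-rotate c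

  Has3Cycle-invert : ∀ {x y z} → Has3Cycle x y z → Has3Cycle y x z
  Has3Cycle-invert (π , p , c) = π ⁻¹ , inverse p , Is3Cycle-invert c

  Has3Cycle-conjugate : ∀ {ρ x y z} → ⟨gen⟩ ρ → Has3Cycle x y z → Has3Cycle (to ρ x) (to ρ y) (to ρ z)
  Has3Cycle-conjugate {ρ} r (π , p , c) = _ , product r (product p (inverse r)) , Is3Cycle-conjugate ρ c

  ≋-sym : ∀ {x y} → x ≋ y → y ≋ x
  ≋-sym (inj₁ x≡y)     = inj₁ (sym x≡y)
  ≋-sym (inj₂ (z , c)) = inj₂ (z , Has3Cycle-invert c)

  ≋-invariant : ∀ {ρ x y} → ⟨gen⟩ ρ → x ≋ y → to ρ x ≋ to ρ y
  ≋-invariant {ρ} r (inj₁ x≡y)     = inj₁ (cong (to ρ) x≡y)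
  ≋-invariant     r (inj₂ (z , c)) = inj₂ (_ , Has3Cycle-conjugate r c)

module _ {A : Set} (_≟_ : DecidableEquality A) where

  private
    swapMap : A → A → A → A
    swapMap x y a with a ≟ x | a ≟ y
    ... | yes _ | _     = y
    ... | no _  | yes _ = x
    ... | no _  | no _  = a

  swapMap-left : ∀ x y → swapMap x y x ≡ y
  swapMap-left x y with x ≟ x | x ≟ y
  ... | yes _  | _ = refl
  ... | no x≢x | _ = contradiction refl x≢x

  swapMap-right : ∀ x y → swapMap x y y ≡ x
  swapMap-right x y with y ≟ x | y ≟ y
  ... | yes y≡x | _      = y≡x
  ... | no _    | yes _  = refl
  ... | no _    | no y≢y = contradiction refl y≢y

  swapMap-fixes : ∀ {x y a} → a ≢ x → a ≢ y → swapMap x y a ≡ a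
  swapMap-fixes {x} {y} {a} a≢x a≢y with a ≟ x | a ≟ y
  ... | yes a≡x | _       = contradiction a≡x a≢x
  ... | no _    | yes a≡y = contradiction a≡y a≢y
  ... | no _    | no _    = refl

  swapMap-involutive : ∀ x y a → swapMap x y (swapMap x y a) ≡ a
  swapMap-involutive x y a with a ≟ x | a ≟ y
  ... | yes refl | _        = swapMap-right x y
  ... | no _     | yes refl = swapMap-left x y
  ... | no a≢x   | no a≢y   = swapMap-fixes a≢x a≢y

  swap : A → A → A ↔ A
  swap x y = mk↔ₛ′ (swapMap x y) (swapMap x y) (swapMap-involutive x y) (swapMap-involutive x y)

  open Group (𝔖 A) using (_≈_; _∙_; ε; ∙-cong)

  transposition≈swap : ∀ τ ((x , y , _) : IsTransposition τ) → τ ≈ swap x y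
  transposition≈swap τ (x , y , _ , x↦y , y↦x , fix) a with a ≟ x | a ≟ y
  ... | yes refl | _        = x↦y
  ... | no _     | yes refl = y↦x
  ... | no a≢x   | no a≢y   = fix a a≢x a≢y

  3cycle≈swap∙swap : ∀ {π x y z} → Is3Cycle π x y z → π ≈ swap x y ∙ swap y z
  3cycle≈swap∙swap {π} {x} {y} {z} c a = cases (a ≟ x) (a ≟ y) (a ≟ z)
    where
    open Is3Cycle c
    via : ∀ {d e} → to π a ≡ e → swapMap y z a ≡ d → swapMap x y d ≡ e →
          to π a ≡ swapMap x y (swapMap y z a)
    via a↦e a↦d d↦e = trans a↦e (sym (trans (cong (swapMap x y) a↦d) d↦e))
    cases : Dec (a ≡ x) → Dec (a ≡ y) → Dec (a ≡ z) → to π a ≡ swapMap x y (swapMap y z a)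
    cases (yes refl) _ _ = via x↦y (swapMap-fixes x≢y (≢-sym z≢x)) (swapMap-left x y)
    cases _ (yes refl) _ = via y↦z (swapMap-left y z) (swapMap-fixes z≢x (≢-sym y≢z))
    cases _ _ (yes refl) = via z↦x (swapMap-right y z) (swapMap-right x y)
    cases (no a≢x) (no a≢y) (no a≢z) =
      via (fixes a a≢x a≢y a≢z) (swapMap-fixes a≢y a≢z) (swapMap-fixes a≢x a≢y)

  module _ {I : Set} {gen : I → A ↔ A} where
    private
      ⟨gen⟩ : A ↔ A → Set
      ⟨gen⟩ = GeneratedBy (𝔖 A) gen

    -- At hand are cycles `(x y z)` and `(y w u)`. If `u` is `x`, the second already contains both
    -- `x` and `w`. If `x` is neither `w` nor `u`, the second fixes `x` and sends `y` to `w`, so it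
    -- conjugates the first into a cycle beginning with `x`, `w`.
    ≋-trans : ∀ {x y w} → _≋_ gen x y → _≋_ gen y w → _≋_ gen x w
    ≋-trans (inj₁ refl) y≋w = y≋w
    ≋-trans x≋y@(inj₂ _) (inj₁ refl) = x≋y
    ≋-trans {x} {y} {w} (inj₂ (z , c)) (inj₂ (u , d@(ρ , r , e))) with x ≟ w | x ≟ u
    ... | yes x≡w | _        = inj₁ x≡w
    ... | no _    | yes refl = inj₂ (y ,
      Has3Cycle-rotate gen (Has3Cycle-rotate gen (Has3Cycle-invert gen d)))
    ... | no x≢w  | no x≢u   = inj₂ (to ρ z ,
      subst₂ (λ a b → Has3Cycle gen a b (to ρ z))
        (fixes e x (x≢y (proj₂ (proj₂ c))) x≢w x≢u) (x↦y e) (Has3Cycle-conjugate gen r c))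
      where open Is3Cycle

    -- Totality gives cycles `(x y a)` and `(a z b)`. If `b` is neither `x` nor `y`, conjugating the
    -- first by the second replaces `a` by `z`. If `b` is `x` or `y`, the second is conjugated by
    -- the first or by its inverse; this yields `(x z y)`, to be inverted, or `(y z x)`.
    ≋-total⇒Has3Cycle : (∀ x y → _≋_ gen x y) → ∀ {x y z} → x ≢ y → y ≢ z → z ≢ x → Has3Cycle gen x y z
    ≋-total⇒Has3Cycle total {x} {y} {z} x≢y y≢z z≢x with total x y
    ... | inj₁ x≡y = contradiction x≡y x≢y
    ... | inj₂ (a , c@(π , p , d)) with total a z
    ...   | inj₁ refl = c
    ...   | inj₂ (b , e@(ρ , r , f)) with x ≟ b | y ≟ b
    ...     | yes refl | _ = Has3Cycle-rotate gen (Has3Cycle-invert gen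
      (subst₂ (λ u v → Has3Cycle gen u v y) D.z↦x (D.fixes z z≢x (≢-sym y≢z) (≢-sym F.x≢y))
        (subst (Has3Cycle gen _ _) D.x↦y (Has3Cycle-conjugate gen p e))))
      where module D = Is3Cycle d
            module F = Is3Cycle f
    ...     | no _ | yes refl = Has3Cycle-rotate gen (Has3Cycle-rotate gen
      (subst₂ (λ u v → Has3Cycle gen u v x) D.y↦z (D.fixes z z≢x (≢-sym F.x≢y) (≢-sym y≢z))
        (subst (Has3Cycle gen _ _) D.z↦x (Has3Cycle-conjugate gen (inverse p) e))))
      where module D = Is3Cycle (Is3Cycle-rotate (Is3Cycle-invert d))
            module F = Is3Cycle f
    ...     | no x≢b | no y≢b =
      subst₂ (λ u v → Has3Cycle gen u v z)
        (F.fixes x (≢-sym D.z≢x) (≢-sym z≢x) x≢b) (F.fixes y D.y≢z y≢z y≢b)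
        (subst (Has3Cycle gen _ _) F.x↦y (Has3Cycle-conjugate gen r c))
      where module D = Is3Cycle d
            module F = Is3Cycle f

    module _ (all3Cycles : ∀ {x y z} → x ≢ y → y ≢ z → z ≢ x → Has3Cycle gen x y z) where

      swap∙swap : ∀ {x y z} → x ≢ y → y ≢ z → ⟨gen⟩ (swap x y ∙ swap y z)
      swap∙swap {x} {y} {z} x≢y y≢z with z ≟ x
      ... | no z≢x = let π , p , c = all3Cycles x≢y y≢z z≢x in respects (3cycle≈swap∙swap c) p
      -- Both factors are now the same transposition and cancel.
      ... | yes refl = respects (λ a → sym (undo a)) identity
        where
        undo : ∀ a → swapMap x y (swapMap y x a) ≡ a
        undo a with a ≟ y | a ≟ x
        ... | yes refl | _        = swapMap-left x y
        ... | no _     | yes refl = swapMap-right x y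
        ... | no a≢y   | no a≢x   = swapMap-fixes a≢x a≢y

      transposition∙transposition : ∀ τ υ → IsTransposition τ → IsTransposition υ → ⟨gen⟩ (τ ∙ υ)
      transposition∙transposition τ υ t@(a , b , a≢b , _) u@(c , d , c≢d , _) =
        respects (λ z → sym (∙-cong {τ} {swap a b} {υ} {swap c d}
          (transposition≈swap τ t) (transposition≈swap υ u) z)) swaps
        where
        swaps : ⟨gen⟩ (swap a b ∙ swap c d)
        swaps with b ≟ c
        ... | yes refl = swap∙swap a≢b c≢d
        -- `(a b)(c d) = (a b)(b c) · (b c)(c d)`, and in each half the two transpositions share a
        -- point.
        ... | no b≢c   = respects
          (λ z → cong (swapMap a b) (swapMap-involutive b c (swapMap c d z)))
          (product (swap∙swap a≢b b≢c) (swap∙swap b≢c c≢d))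

      even⇒generated : ∀ π → IsEven π → ⟨gen⟩ π
      even⇒generated π (τs , ts , 2∣ , π≈) = respects (λ z → sym (π≈ z)) (pairs ts 2∣)
        where
        pairs : ∀ {τs} → All IsTransposition τs → 2 ∣ length τs → ⟨gen⟩ (foldr _∙_ ε τs)
        pairs []           _  = identity
        pairs (t ∷ [])     2∣ with () ← ∣1⇒≡1 2∣
        pairs (_∷_ {τ} t (_∷_ {υ} u ts)) 2∣ = respects (λ _ → refl)
          (product (transposition∙transposition τ υ t u) (pairs ts (∣m+n∣m⇒∣n 2∣ ∣-refl)))

-- Toggles of independent sets

e∉X-e : ∀ (X : Subset n) e → e ∉ (X - e)
e∉X-e (_ ∷ X) (suc e) (there e∈) = e∉X-e X e e∈

Member-≟ : (F : SetFamily n) → DecidableEquality (Member F)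
Member-≟ _ = Refinement._≟_ (≡-dec _≟ᴮ_)

Member-ext : {F : SetFamily n} {x y : Member F} →
             (∀ f → f ∈ value x ⇔ f ∈ value y) → x ≡ y
Member-ext eq = value-injective (⊆-antisym (λ {f} → ⇒ (eq f)) (λ {f} → ⇐ (eq f)))

toggle-∈-≢ : ∀ (F : SetFamily n) e (x : Member F) {f} → f ≢ e →
             f ∈ value (toggleMap F e x) ⇔ f ∈ value x
toggle-∈-≢ F e (X , p) f≢e with e ∈? X
... | no _ with 𝓛? F (X ∪ ⁅ e ⁆)
...   | yes _ = mk⇔ ([ (λ f∈X → f∈X) , (λ f∈e → contradiction (x∈⁅y⁆⇒x≡y e f∈e) f≢e) ]′ ∘ x∈p∪q⁻ X ⁅ e ⁆)
                    (x∈p∪q⁺ ∘ inj₁)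
...   | no _  = mk⇔ (λ f∈X → f∈X) (λ f∈X → f∈X)
toggle-∈-≢ F e (X , p) f≢e | yes _ with 𝓛? F (X - e)
...   | yes _ = mk⇔ (p─q⊆p X ⁅ e ⁆) (λ f∈X → x∈p∧x≢y⇒x∈p-y f∈X f≢e)
...   | no _  = mk⇔ (λ f∈X → f∈X) (λ f∈X → f∈X)

module _ (G : Graph n) where
  open Graph G

  independent : (x : Member (IS G)) → Independent G (value x)
  independent (X , [ p ]) = recompute (independent? G X) p

  ∈V : ∀ (x : Member (IS G)) {f} → f ∈ value x → f ∈ V
  ∈V x = proj₁ (independent x)

  Addable : Fin n → Subset n → Set
  Addable e X = e ∉ X × e ∈ V × (∀ {w} → w ∈ X → ¬ e ~ w)

  -- Independence passes to subsets, so toggling a vertex that is present always removes it, and the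
  -- last case is absurd. Together with `toggle-∈-≢` this determines a toggled set by membership, so
  -- that the case split in `toggleMap` need not be reopened.
  toggle-∈-≡ : ∀ e (x : Member (IS G)) →
               e ∈ value (toggleMap (IS G) e x) ⇔ Addable e (value x)
  toggle-∈-≡ e x@(X , p) with e ∈? X
  ... | no e∉X with independent? G (X ∪ ⁅ e ⁆)
  ...   | yes (⊆V , q) = mk⇔
    (λ e∈X∪e → e∉X , ⊆V e∈X∪e , λ w∈X → q _ _ e∈X∪e (x∈p∪q⁺ (inj₁ w∈X)))
    (λ _ → x∈p∪q⁺ (inj₂ (x∈⁅x⁆ e)))
  ...   | no ¬q = mk⇔ (λ e∈X → contradiction e∈X e∉X) λ (_ , e∈V , free) → contradiction
    ( (λ f∈ → [ ∈V x , (λ f∈e → subst (_∈ V) (sym (x∈⁅y⁆⇒x≡y e f∈e)) e∈V) ]′ (x∈p∪q⁻ X ⁅ e ⁆ f∈))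
    , λ u v u∈ v∈ u~v → non-adjacent e∈V free (split u∈) (split v∈) u~v) ¬q
    where
    split : ∀ {u} → u ∈ X ∪ ⁅ e ⁆ → u ∈ X ⊎ u ≡ e
    split u∈ = [ inj₁ , inj₂ ∘ x∈⁅y⁆⇒x≡y e ]′ (x∈p∪q⁻ X ⁅ e ⁆ u∈)
    non-adjacent : e ∈ V → (∀ {w} → w ∈ X → ¬ e ~ w) →
                   ∀ {u v} → u ∈ X ⊎ u ≡ e → v ∈ X ⊎ v ≡ e → ¬ u ~ v
    non-adjacent _ free (inj₁ u∈X)  (inj₁ v∈X)  u~v = proj₂ (independent x) _ _ u∈X v∈X u~v
    non-adjacent _ free (inj₁ u∈X)  (inj₂ refl) u~v = free u∈X (~-sym u~v)
    non-adjacent _ free (inj₂ refl) (inj₁ v∈X)  u~v = free v∈X u~v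
    non-adjacent _ free (inj₂ refl) (inj₂ refl) u~v = ~-irrefl refl u~v
  toggle-∈-≡ e x@(X , p) | yes e∈X with independent? G (X - e)
  ...   | yes _ = mk⇔ (λ e∈ → contradiction e∈ (e∉X-e X e)) (λ (e∉X , _) → contradiction e∈X e∉X)
  ...   | no ¬q = contradiction
    ( (λ f∈ → ∈V x (p─q⊆p X ⁅ e ⁆ f∈))
    , λ u v u∈ v∈ → proj₂ (independent x) u v (p─q⊆p X ⁅ e ⁆ u∈) (p─q⊆p X ⁅ e ⁆ v∈)) ¬q

module _ (G : Graph n) where
  open Graph G

  private
    t : Fin n → Member (IS G) → Member (IS G)
    t = toggleMap (IS G)

  ⟨toggles⟩ : Member (IS G) ↔ Member (IS G) → Set
  ⟨toggles⟩ = GeneratedBy (𝔖 (Member (IS G))) (toggle (IS G))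

  HasToggle3Cycle : (x y z : Member (IS G)) → Set
  HasToggle3Cycle = Has3Cycle (toggle (IS G))

  infix 4 _≈_

  _≈_ : (x y : Member (IS G)) → Set
  _≈_ = _≋_ (toggle (IS G))

  toggle-∈-remove : ∀ {e} x → e ∈ value x → ∀ f → f ∈ value (t e x) ⇔ (f ∈ value x × f ≢ e)
  toggle-∈-remove {e} x e∈x f with f ≟ e
  ... | yes refl = mk⇔ (λ e∈ → contradiction e∈x (proj₁ (⇒ (toggle-∈-≡ G e x) e∈)))
                       (λ (_ , e≢e) → contradiction refl e≢e)
  ... | no f≢e   = mk⇔ (λ f∈ → ⇒ (toggle-∈-≢ (IS G) e x f≢e) f∈ , f≢e)
                       (λ (f∈x , _) → ⇐ (toggle-∈-≢ (IS G) e x f≢e) f∈x)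

  -- The neighbour `w` keeps `e` out of the independent set `x` and also blocks its insertion.
  toggle-fixed : ∀ {e w} x → w ∈ value x → e ~ w → t e x ≡ x
  toggle-fixed {e} {w} x w∈x e~w = Member-ext {F = IS G} λ f → cases f (f ≟ e)
    where
    cases : ∀ f → Dec (f ≡ e) → f ∈ value (t e x) ⇔ f ∈ value x
    cases f (yes refl) = mk⇔
      (λ e∈ → contradiction e~w (proj₂ (proj₂ (⇒ (toggle-∈-≡ G e x) e∈)) w∈x))
      (λ e∈x → contradiction e~w (proj₂ (independent G x) e w e∈x w∈x))
    cases f (no f≢e) = toggle-∈-≢ (IS G) e x f≢e

  empty : Member (IS G)
  empty = ⊥ , [ (λ f∈⊥ → contradiction f∈⊥ ∉⊥) , (λ _ _ u∈⊥ → contradiction u∈⊥ ∉⊥) ]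

  -- Defined by toggling, so that `t w empty` is `singleton w` by computation. For `w` outside `V`
  -- the value is just the empty set, which is why `∈singleton` asks for `w ∈ V`.
  singleton : Fin n → Member (IS G)
  singleton w = t w empty

  ∈singleton : ∀ {w} → w ∈ V → ∀ f → f ∈ value (singleton w) ⇔ f ≡ w
  ∈singleton {w} w∈V f with f ≟ w
  ... | yes refl = mk⇔ (λ _ → refl)
    (λ _ → ⇐ (toggle-∈-≡ G w empty) (∉⊥ , w∈V , λ u∈⊥ → contradiction u∈⊥ ∉⊥))
  ... | no f≢w   = mk⇔ (λ f∈ → contradiction (⇒ (toggle-∈-≢ (IS G) w empty f≢w) f∈) ∉⊥)
                       (λ f≡w → contradiction f≡w f≢w)

  Empty⇒≡empty : ∀ (x : Member (IS G)) → ¬ (∃ (_∈ value x)) → x ≡ empty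
  Empty⇒≡empty x ¬∃ = value-injective (Empty-unique ¬∃)

  toggle-≈ : ∀ {e x y} → e ∈ V → x ≈ y → t e x ≈ t e y
  toggle-≈ {e} e∈V = ≋-invariant (toggle (IS G)) (generator (e , e∈V))

  -- Toggling `v` turns the empty set into `{v}` and fixes `{u}`, so it carries the hypothesis to
  -- `{v} ≈ {u}`.
  edge-≈ : ∀ {u v} → u ~ v → empty ≈ singleton u → empty ≈ singleton v
  edge-≈ {u} {v} u~v eq = ≋-trans (Member-≟ (IS G)) eq (≋-sym _
    (subst (singleton v ≈_) (toggle-fixed (singleton u) (⇐ (∈singleton (~⇒∈V u~v) u) refl) (~-sym u~v))
      (toggle-≈ (~⇒∈V (~-sym u~v)) eq)))

  -- For e, f ∈ x: removing f gives t f x, which is equivalent to t f x without e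
  -- by induction, and adding f back turns this into x ≈ t e x.
  ≈-empty : (∀ {w} → w ∈ V → empty ≈ singleton w) → ∀ x → x ≈ empty
  ≈-empty singletons x = go (suc ∣ value x ∣) x ≤-refl
    where
    shrinks : ∀ {e} x → e ∈ value x → ∣ value (t e x) ∣ < ∣ value x ∣
    shrinks {e} x e∈x = p⊂q⇒∣p∣<∣q∣
      ( (λ {f} f∈ → proj₁ (⇒ (toggle-∈-remove x e∈x f) f∈))
      , e , e∈x , λ e∈ → proj₂ (⇒ (toggle-∈-remove x e∈x e) e∈) refl)

    go : ∀ m x → ∣ value x ∣ < m → x ≈ empty
    go (suc m) x x<m with nonempty? (value x)
    ... | no ¬∃ = inj₁ (Empty⇒≡empty x ¬∃)
    ... | yes (e , e∈x) with nonempty? (value (t e x))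
    ...   | no ¬∃ = ≋-sym _ (subst (empty ≈_) (Member-ext {F = IS G} only) (singletons e∈V))
      where
      e∈V = ∈V G x e∈x
      only : ∀ f → f ∈ value (singleton e) ⇔ f ∈ value x
      only f with f ≟ e
      ... | yes refl = mk⇔ (λ _ → e∈x) (λ _ → ⇐ (∈singleton e∈V e) refl)
      ... | no f≢e = mk⇔ (λ f∈ → contradiction (⇒ (∈singleton e∈V f) f∈) f≢e)
                         (λ f∈x → contradiction (f , ⇐ (toggle-∈-remove x e∈x f) (f∈x , f≢e)) ¬∃)
    ...   | yes (f , f∈y) = ≋-trans (Member-≟ (IS G))
      (subst₂ _≈_ (toggleMap-involutive (IS G) f x) (Member-ext {F = IS G} {t f y₂} {t e x} agree)
        (toggle-≈ (∈V G x f∈x)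
          (≋-trans (Member-≟ (IS G)) (small (shrinks x f∈x))
            (≋-sym _ (small (<-trans (shrinks y₁ e∈y₁) (shrinks x f∈x)))))))
      (small (shrinks x e∈x))
      where
      small : ∀ {y} → ∣ value y ∣ < ∣ value x ∣ → y ≈ empty
      small y<x = go m _ (<-≤-trans y<x (s≤s⁻¹ x<m))
      f∈x = proj₁ (⇒ (toggle-∈-remove x e∈x f) f∈y)
      f≢e = proj₂ (⇒ (toggle-∈-remove x e∈x f) f∈y)
      y₁ = t f x
      e∈y₁ = ⇐ (toggle-∈-remove x f∈x e) (e∈x , ≢-sym f≢e)
      y₂ = t e y₁
      ∈y₂⇒∈x : ∀ {g} → g ∈ value y₂ → g ∈ value x × g ≢ f × g ≢ e
      ∈y₂⇒∈x {g} g∈ = let g∈y₁ , g≢e = ⇒ (toggle-∈-remove y₁ e∈y₁ g) g∈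
                          g∈x , g≢f = ⇒ (toggle-∈-remove x f∈x g) g∈y₁ in g∈x , g≢f , g≢e
      agree : ∀ g → g ∈ value (t f y₂) ⇔ g ∈ value (t e x)
      agree g with g ≟ f
      ... | yes refl = mk⇔ (λ _ → f∈y) (λ _ → ⇐ (toggle-∈-≡ G f y₂)
        ( (λ f∈ → proj₁ (proj₂ (∈y₂⇒∈x f∈)) refl) , ∈V G x f∈x
        , λ w∈ → proj₂ (independent G x) f _ f∈x (proj₁ (∈y₂⇒∈x w∈))))
      ... | no g≢f = mk⇔
        (λ g∈ → let g∈x , _ , g≢e = ∈y₂⇒∈x (⇒ (toggle-∈-≢ (IS G) f y₂ g≢f) g∈) in
          ⇐ (toggle-∈-remove x e∈x g) (g∈x , g≢e))
        (λ g∈ → let g∈x , g≢e = ⇒ (toggle-∈-remove x e∈x g) g∈ in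
          ⇐ (toggle-∈-≢ (IS G) f y₂ g≢f)
            (⇐ (toggle-∈-remove y₁ e∈y₁ g) (⇐ (toggle-∈-remove x f∈x g) (g∈x , g≢f) , g≢e)))

  -- Walks from `w` spread the hypothesis to all singletons by `edge-≈`; then every member is linked
  -- to `empty`.
  connected⇒≈ : Connected G → ∀ {w} → w ∈ V → empty ≈ singleton w → ∀ x y → x ≈ y
  connected⇒≈ connected {w} w∈V eq x y = ≋-trans (Member-≟ (IS G)) (all x) (≋-sym _ (all y))
    where
    walk : ∀ {u v} → Star _~_ u v → empty ≈ singleton u → empty ≈ singleton v
    walk ε⋆         = id
    walk (u~u′ ◅ s) = walk s ∘ edge-≈ u~u′
    all : ∀ x → x ≈ empty
    all = ≈-empty λ v∈V → walk (connected w∈V v∈V) eq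

-- Restriction to induced subgraphs

module _ {A B I J : Set} (gen : I → A ↔ A) (gen′ : J → B ↔ B)
         (_∼_ : (A → A) → (B → B) → Set)
         (∼-id   : id ∼ id)
         (∼-∘    : ∀ {f f′ g g′} → f ∼ g → f′ ∼ g′ → (f ∘ f′) ∼ (g ∘ g′))
         (∼-resp : ∀ {f f′ g} → (∀ x → f x ≡ f′ x) → f ∼ g → f′ ∼ g)
         (∼-gen  : ∀ i → ∃[ ρ ] GeneratedBy (𝔖 B) gen′ ρ × to (gen i) ∼ to ρ × from (gen i) ∼ from ρ)
         where

  -- Induction on the derivation, following `to` and `from` together: the case of an inverse just
  -- exchanges them. The result mirrors the derivation constructor by constructor. It serves both
  -- for lifting from a subgraph and for projecting onto one.
  transfer : ∀ {π} → GeneratedBy (𝔖 A) gen π →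
             ∃[ ρ ] GeneratedBy (𝔖 B) gen′ ρ × to π ∼ to ρ × from π ∼ from ρ
  transfer (generator i) = ∼-gen i
  transfer identity = _ , identity , ∼-id , ∼-id
  transfer (product p q) =
    let _ , p′ , p∼ , p⁻¹∼ = transfer p
        _ , q′ , q∼ , q⁻¹∼ = transfer q
    in  _ , product p′ q′ , ∼-∘ p∼ q∼ , ∼-∘ q⁻¹∼ p⁻¹∼
  transfer (inverse p) =
    let _ , p′ , p∼ , p⁻¹∼ = transfer p
    in  _ , inverse p′ , p⁻¹∼ , p∼
  transfer (respects {π} {ρ} π≈ρ p) =
    let _ , p′ , p∼ , p⁻¹∼ = transfer p
    in  _ , p′ , ∼-resp π≈ρ p∼ , ∼-resp (Group.⁻¹-cong (𝔖 A) {π} {ρ} π≈ρ) p⁻¹∼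

-- A relation instead of an equation `H ≡ induced G U`, so that `induced G U` can be compared with
-- `induced G W` directly, and not through the iterated `induced (induced G W) U`.
record _IsRestrictionOf_To_ (H G : Graph n) (U : Subset n) : Set where
  private
    module G = Graph G
    module H = Graph H
  field
    ∈V⇔ : ∀ {f} → f ∈ H.V ⇔ (f ∈ G.V × f ∈ U)
    ~⇔  : ∀ {u v} → u H.~ v ⇔ (u ∈ U × v ∈ U × u G.~ v)

open _IsRestrictionOf_To_

induced-restriction : ∀ (G : Graph n) U → (induced G U) IsRestrictionOf G To U
induced-restriction G U = record
  { ∈V⇔ = mk⇔ (x∈p∩q⁻ _ _) x∈p∩q⁺
  ; ~⇔  = ⇔-refl
  }

induced-⊆-restriction : ∀ (G : Graph n) {U W} → U ⊆ W →
                        (induced G U) IsRestrictionOf (induced G W) To U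
induced-⊆-restriction G {U} {W} U⊆W = record
  { ∈V⇔ = mk⇔
      (λ f∈ → let f∈V , f∈U = x∈p∩q⁻ V U f∈ in x∈p∩q⁺ (f∈V , U⊆W f∈U) , f∈U)
      (λ (f∈ , f∈U) → x∈p∩q⁺ (proj₁ (x∈p∩q⁻ V W f∈) , f∈U))
  ; ~⇔  = mk⇔
      (λ (u∈ , v∈ , u~v) → u∈ , v∈ , U⊆W u∈ , U⊆W v∈ , u~v)
      (λ (u∈ , v∈ , _ , _ , u~v) → u∈ , v∈ , u~v)
  }
  where open Graph G

module _ {G H : Graph n} {U : Subset n} (H≤G : H IsRestrictionOf G To U) where
  private
    module G = Graph G
    module H = Graph H

  -- The field detached says that no vertex of x′ outside U is adjacent to U,
  -- so that toggling vertices of U acts on x′ as on its trace x.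
  record TraceOf (x′ : Member (IS G)) (x : Member (IS H)) : Set where
    field
      agree    : ∀ {f} → f ∈ U → f ∈ value x′ ⇔ f ∈ value x
      detached : ∀ {f u} → f ∈ value x′ → f ∉ U → u ∈ U → ¬ u G.~ f

  open TraceOf

  ∈x⇒∈U : ∀ (x : Member (IS H)) {f} → f ∈ value x → f ∈ U
  ∈x⇒∈U x f∈x = proj₂ (⇒ (∈V⇔ H≤G) (∈V H x f∈x))

  trace-unique : ∀ {x′ x y} → TraceOf x′ x → TraceOf x′ y → x ≡ y
  trace-unique {_} {x} {y} r s = Member-ext {F = IS H} λ f → mk⇔
    (λ f∈x → let f∈U = ∈x⇒∈U x f∈x in ⇒ (agree s f∈U) (⇐ (agree r f∈U) f∈x))
    (λ f∈y → let f∈U = ∈x⇒∈U y f∈y in ⇒ (agree r f∈U) (⇐ (agree s f∈U) f∈y))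

  -- Only the vertex `e` itself is delicate. By `detached`, all neighbours of `e` in `x′` lie in
  -- `U`, hence in `x`, so `e` can be added to `x′` in `G` exactly when it can be added to `x` in
  -- `H`.
  trace-toggle : ∀ {e x′ x} → e ∈ U → TraceOf x′ x →
                 TraceOf (toggleMap (IS G) e x′) (toggleMap (IS H) e x)
  trace-toggle {e} {x′} {x} e∈U r = record
    { agree    = λ {f} → agree-toggle f
    ; detached = λ {f} f∈ f∉U → detached r
        (⇒ (toggle-∈-≢ (IS G) e x′ λ f≡e → f∉U (subst (_∈ U) (sym f≡e) e∈U)) f∈) f∉U
    }
    where
    agree-toggle : ∀ f → f ∈ U → f ∈ value (toggleMap (IS G) e x′) ⇔ f ∈ value (toggleMap (IS H) e x)
    agree-toggle f f∈U with f ≟ e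
    ... | no f≢e = ⇔-trans (toggle-∈-≢ (IS G) e x′ f≢e)
      (⇔-trans (agree r f∈U) (⇔-sym (toggle-∈-≢ (IS H) e x f≢e)))
    ... | yes refl = ⇔-trans (toggle-∈-≡ G e x′) (⇔-trans (mk⇔
      (λ (e∉x′ , e∈V , free) → e∉x′ ∘ ⇐ (agree r e∈U) , ⇐ (∈V⇔ H≤G) (e∈V , e∈U) ,
        λ w∈x e~w → free (⇐ (agree r (∈x⇒∈U x w∈x)) w∈x) (proj₂ (proj₂ (⇒ (~⇔ H≤G) e~w))))
      (λ (e∉x , e∈V , free) → e∉x ∘ ⇒ (agree r e∈U) , proj₁ (⇒ (∈V⇔ H≤G) e∈V) , free′ free))
      (⇔-sym (toggle-∈-≡ H e x)))
      where
      free′ : (∀ {w} → w ∈ value x → ¬ e H.~ w) → ∀ {w} → w ∈ value x′ → ¬ e G.~ w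
      free′ free {w} w∈x′ e~w with w ∈? U
      ... | yes w∈U = free (⇒ (agree r w∈U) w∈x′) (⇐ (~⇔ H≤G) (e∈U , w∈U , e~w))
      ... | no w∉U  = detached r w∈x′ w∉U e∈U e~w

  embed : Member (IS H) → Member (IS G)
  embed x = value x , [ (λ f∈x → proj₁ (⇒ (∈V⇔ H≤G) (∈V H x f∈x)))
    , (λ u v u∈x v∈x u~v → proj₂ (independent H x) u v u∈x v∈x
        (⇐ (~⇔ H≤G) (∈x⇒∈U x u∈x , ∈x⇒∈U x v∈x , u~v))) ]

  trace-embed : ∀ x → TraceOf (embed x) x
  trace-embed x = record
    { agree    = λ _ → ⇔-refl
    ; detached = λ f∈x f∉U → contradiction (∈x⇒∈U x f∈x) f∉U
    }

  restrict : Member (IS G) → Member (IS H)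
  restrict x′ = value x′ ∩ U , [ (λ f∈ → let f∈x , f∈U = split f∈ in ⇐ (∈V⇔ H≤G) (∈V G x′ f∈x , f∈U))
    , (λ u v u∈ v∈ u~v → proj₂ (independent G x′) u v (proj₁ (split u∈)) (proj₁ (split v∈))
        (proj₂ (proj₂ (⇒ (~⇔ H≤G) u~v)))) ]
    where
    split : ∀ {f} → f ∈ value x′ ∩ U → f ∈ value x′ × f ∈ U
    split = x∈p∩q⁻ (value x′) U

  restrict-agree : ∀ x′ {f} → f ∈ U → f ∈ value x′ ⇔ f ∈ value (restrict x′)
  restrict-agree x′ f∈U = mk⇔ (λ f∈x′ → x∈p∩q⁺ (f∈x′ , f∈U)) (proj₁ ∘ x∈p∩q⁻ (value x′) U)

  private
    Member-G = Member (IS G)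
    Member-H = Member (IS H)

  -- Only those `x′` that are detached have to follow `f`. On all others `g` is controlled outside
  -- `U` alone, since vertices there may block toggles in `U`.
  record Lifts (f : Member-H → Member-H) (g : Member-G → Member-G) : Set where
    field
      outside-fixed : ∀ x′ {e} → e ∉ U → e ∈ value (g x′) ⇔ e ∈ value x′
      trace-lift    : ∀ {x′ x} → TraceOf x′ x → TraceOf (g x′) (f x)

  open Lifts

  toggle-lifts : ∀ e → e ∈ U → Lifts (toggleMap (IS H) e) (toggleMap (IS G) e)
  toggle-lifts e e∈U = record
    { outside-fixed = λ x′ f∉U →
        toggle-∈-≢ (IS G) e x′ λ f≡e → f∉U (subst (_∈ U) (sym f≡e) e∈U)
    ; trace-lift    = trace-toggle e∈U
    }

  lift : ∀ {π} → ⟨toggles⟩ H π → ∃[ ρ ] ⟨toggles⟩ G ρ × Lifts (to π) (to ρ) × Lifts (from π) (from ρ)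
  lift = transfer (toggle (IS H)) (toggle (IS G)) Lifts
    (record { outside-fixed = λ _ _ → ⇔-refl ; trace-lift = id })
    (λ p q → record
      { outside-fixed = λ x′ e∉U → ⇔-trans (outside-fixed p _ e∉U) (outside-fixed q x′ e∉U)
      ; trace-lift    = trace-lift p ∘ trace-lift q
      })
    (λ f≗f′ p → record
      { outside-fixed = outside-fixed p
      ; trace-lift    = λ {x′} {x} r → subst (TraceOf _) (f≗f′ x) (trace-lift p r)
      })
    λ (e , e∈) → let e∈V , e∈U = ⇒ (∈V⇔ H≤G) e∈ in
      _ , generator (e , e∈V) , toggle-lifts e e∈U , toggle-lifts e e∈U

  lifts-embed : ∀ {f g} → Lifts f g → ∀ x → g (embed x) ≡ embed (f x)
  lifts-embed {f} {g} p x = Member-ext {F = IS G} λ e → cases e (e ∈? U)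
    where
    cases : ∀ e → Dec (e ∈ U) → e ∈ value (g (embed x)) ⇔ e ∈ value (f x)
    cases e (yes e∈U) = agree (trace-lift p (trace-embed x)) e∈U
    cases e (no e∉U) = mk⇔
      (λ e∈ → contradiction (∈x⇒∈U x (⇒ (outside-fixed p (embed x) e∉U) e∈)) e∉U)
      (λ e∈ → contradiction (∈x⇒∈U (f x) e∈) e∉U)

-- Connected graphs

module _ {A : Set} where
  open Group (𝔖 A) using (_∙_; _⁻¹)

  -- Since `τ` exchanges `x` and `y` and fixes `z`, conjugation by it turns `π` into `(y x z)`,
  -- which is `π⁻¹`; the product is then `π⁻² = π`. Away from the three points `τ` may move
  -- anything, as its two occurrences cancel there.
  commutator-3cycle : ∀ {π τ : A ↔ A} {x y z} → Is3Cycle π x y z →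
                      to τ x ≡ y → to τ y ≡ x → to τ z ≡ z → (∀ a → to τ (to τ a) ≡ a) →
                      Is3Cycle (τ ∙ (π ∙ (τ ∙ π ⁻¹))) x y z
  commutator-3cycle {π} {τ} {x} {y} {z} c x↦y y↦x z↦z τ² = record
    { x≢y = K.x≢y ; y≢z = K.y≢z ; z≢x = K.z≢x
    ; x↦y = via (K⁻¹.y↦z) z↦z K.z↦x x↦y
    ; y↦z = via (K⁻¹.x↦y) x↦y K.y↦z z↦z
    ; z↦x = via (K⁻¹.z↦x) y↦x K.x↦y y↦x
    ; fixes = λ a a≢x a≢y a≢z → via (K⁻¹.fixes a a≢y a≢x a≢z) refl
        (K.fixes (to τ a) (λ e → a≢y (trans (sym (τ² a)) (trans (cong (to τ) e) x↦y)))
                          (λ e → a≢x (trans (sym (τ² a)) (trans (cong (to τ) e) y↦x)))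
                          (λ e → a≢z (trans (sym (τ² a)) (trans (cong (to τ) e) z↦z))))
        (τ² a)
    }
    where
    module K   = Is3Cycle c
    module K⁻¹ = Is3Cycle (Is3Cycle-invert c)
    via : ∀ {a b d e f} → from π a ≡ b → to τ b ≡ d → to π d ≡ e → to τ e ≡ f →
          to τ (to π (to τ (from π a))) ≡ f
    via refl refl refl refl = refl

3cycle-along : ∀ {A B : Set} {π : A ↔ A} {ρ : B ↔ B} {x y z} (ι : A → B) →
               (∀ {a a′} → ι a ≡ ι a′ → a ≡ a′) →
               (∀ a → to ρ (ι a) ≡ ι (to π a)) →
               (∀ b → (∃[ a ] b ≡ ι a) ⊎ to ρ b ≡ b) →
               Is3Cycle π x y z → Is3Cycle ρ (ι x) (ι y) (ι z)
3cycle-along {ρ = ρ} ι ι-injective commutes image? c = record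
  { x≢y = x≢y ∘ ι-injective ; y≢z = y≢z ∘ ι-injective ; z≢x = z≢x ∘ ι-injective
  ; x↦y = trans (commutes _) (cong ι x↦y)
  ; y↦z = trans (commutes _) (cong ι y↦z)
  ; z↦x = trans (commutes _) (cong ι z↦x)
  ; fixes = λ b b≢x b≢y b≢z → case-image b≢x b≢y b≢z (image? b)
  }
  where
  open Is3Cycle c
  case-image : ∀ {b} → b ≢ _ → b ≢ _ → b ≢ _ → (∃[ a ] b ≡ ι a) ⊎ to ρ b ≡ b → to ρ b ≡ b
  case-image b≢x b≢y b≢z (inj₁ (a , refl)) =
    trans (commutes a) (cong ι (fixes a (b≢x ∘ cong ι) (b≢y ∘ cong ι) (b≢z ∘ cong ι)))
  case-image _ _ _ (inj₂ eq) = eq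

module _ {G H : Graph n} {U : Subset n} (H≤G : H IsRestrictionOf G To U) where
  private
    module G = Graph G
    module H = Graph H

  -- A lift ρ of the given 3-cycle acts in an unknown way on the independent sets
  -- containing a vertex outside U, but toggling w fixes all of these.
  lift-3cycle : ∀ {w u} → w H.~ u → (∀ {f} → f ∈ G.V → f ∉ U → f G.~ w) →
                HasToggle3Cycle H (empty H) (singleton H w) (singleton H u) →
                HasToggle3Cycle G (empty G) (singleton G w) (singleton G u)
  lift-3cycle {w} {u} w~u outside~w (π , p , c) =
    σ , product t∈ (product q (product t∈ (inverse q))) ,
    subst (λ x → Is3Cycle σ (empty G) x (singleton G u)) (embed-singleton w∈U)
      (subst (Is3Cycle σ (empty G) _) (embed-singleton u∈U)
        (3cycle-along {ρ = σ} ι (λ eq → value-injective (cong value eq)) commutes image?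
          (commutator-3cycle {π = π} {toggle (IS H) (w , w∈V)} c refl
            (toggleMap-involutive (IS H) w (empty H))
            (toggle-fixed H (singleton H u) (⇐ (∈singleton H (H.~⇒∈V (H.~-sym w~u)) u) refl) w~u)
            (toggleMap-involutive (IS H) w))))
    where
    open Group (𝔖 (Member (IS G))) using (_∙_; _⁻¹)
    ι = embed H≤G
    w∈V = H.~⇒∈V w~u
    w∈U = proj₁ (⇒ (~⇔ H≤G) w~u)
    u∈U = proj₁ (proj₂ (⇒ (~⇔ H≤G) w~u))
    τ : Member (IS G) ↔ Member (IS G)
    τ = toggle (IS G) (w , proj₁ (⇒ (∈V⇔ H≤G) w∈V))
    t∈ : ⟨toggles⟩ G τ
    t∈ = generator (w , proj₁ (⇒ (∈V⇔ H≤G) w∈V))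
    ρ = proj₁ (lift H≤G p)
    q = proj₁ (proj₂ (lift H≤G p))
    ρ-lifts = proj₁ (proj₂ (proj₂ (lift H≤G p)))
    ρ⁻¹-lifts = proj₂ (proj₂ (proj₂ (lift H≤G p)))
    σ = τ ∙ (ρ ∙ (τ ∙ ρ ⁻¹))
    embed-toggle : ∀ {e} → e ∈ U → ∀ x → toggleMap (IS G) e (ι x) ≡ ι (toggleMap (IS H) e x)
    embed-toggle {e} e∈U = lifts-embed H≤G (toggle-lifts H≤G e e∈U)
    embed-singleton : ∀ {e} → e ∈ U → ι (singleton H e) ≡ singleton G e
    embed-singleton e∈U = sym (embed-toggle e∈U (empty H))
    commutes : ∀ x → to σ (ι x) ≡ ι (toggleMap (IS H) w (to π (toggleMap (IS H) w (from π x))))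
    commutes x =
      trans (cong (to τ ∘ to ρ ∘ to τ) (lifts-embed H≤G ρ⁻¹-lifts x))
        (trans (cong (to τ ∘ to ρ) (embed-toggle w∈U _))
          (trans (cong (to τ) (lifts-embed H≤G ρ-lifts _)) (embed-toggle w∈U _)))
    image? : ∀ x′ → (∃[ x ] x′ ≡ ι x) ⊎ to σ x′ ≡ x′
    image? x′ with any? (λ f → (f ∈? value x′) ×-dec ¬? (f ∈? U))
    ... | no none = inj₁ (restrict H≤G x′ , Member-ext {F = IS G} λ f → mk⇔
      (λ f∈x′ → x∈p∩q⁺ (f∈x′ , decidable-stable (f ∈? U) λ f∉U → none (f , f∈x′ , f∉U)))
      (proj₁ ∘ x∈p∩q⁻ (value x′) U))
    -- Lifts do not touch `f`, so it also lies in `ρ⁻¹ x′`. Being adjacent to `w`, it makes both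
    -- occurrences of `τ` trivial, and `ρ ρ⁻¹` remains.
    ... | yes (f , f∈x′ , f∉U) = inj₂
      (trans (cong (to τ ∘ to ρ) (fixed (⇐ (Lifts.outside-fixed ρ⁻¹-lifts x′ f∉U) f∈x′)))
        (trans (cong (to τ) (strictlyInverseˡ ρ x′)) (fixed f∈x′)))
      where
      fixed : ∀ {y} → f ∈ value y → to τ y ≡ y
      fixed {y} f∈y = toggle-fixed G y f∈y (G.~-sym (outside~w (∈V G x′ f∈x′) f∉U))

-- The induction hypothesis when growing a connected vertex set.
data Rich (G : Graph n) : Set where
  rich : Connected G → ∀ a b → Graph._~_ G a b →
         HasToggle3Cycle G (empty G) (singleton G a) (singleton G b) → Rich G

module _ (G : Graph n) where
  open Graph G

  rich⇒3cycles : Connected G → ∀ {w} → w ∈ V → ∃ (HasToggle3Cycle G (empty G) (singleton G w)) →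
                 ∀ {x y z} → x ≢ y → y ≢ z → z ≢ x → HasToggle3Cycle G x y z
  rich⇒3cycles connected w∈V c =
    ≋-total⇒Has3Cycle (Member-≟ (IS G)) (connected⇒≈ G connected w∈V (inj₂ c))

  singleton≢empty : ∀ {u} → u ∈ V → empty G ≢ singleton G u
  singleton≢empty {u} u∈V eq = ∉⊥ (subst (u ∈_) (sym (cong value eq)) (⇐ (∈singleton G u∈V u) refl))

  singleton-injective : ∀ {u v} → u ∈ V → v ∈ V → singleton G u ≡ singleton G v → u ≡ v
  singleton-injective {u} u∈V v∈V eq =
    ⇒ (∈singleton G v∈V u) (subst (u ∈_) (cong value eq) (⇐ (∈singleton G u∈V u) refl))

  -- One 3-cycle through `empty` and a singleton yields all of them, so the cycle can be moved to
  -- any vertex `w` and a neighbour `u`. The neighbour is the first step of a walk from `w` to `a`,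
  -- or `b` if that walk is empty.
  rich-at : Rich G → ∀ {w} → w ∈ V →
            ∃[ u ] w ~ u × HasToggle3Cycle G (empty G) (singleton G w) (singleton G u)
  rich-at (rich connected a b a~b c) {w} w∈V = u , w~u ,
    rich⇒3cycles connected (~⇒∈V a~b) (_ , c) (singleton≢empty w∈V)
      (λ eq → ~-irrefl (singleton-injective w∈V u∈V eq) w~u) (≢-sym (singleton≢empty u∈V))
    where
    neighbour : Star _~_ w a → ∃ (w ~_)
    neighbour ε⋆        = b , a~b
    neighbour (w~v ◅ _) = _ , w~v
    u = proj₁ (neighbour (connected w∈V (~⇒∈V a~b)))
    w~u = proj₂ (neighbour (connected w∈V (~⇒∈V a~b)))
    u∈V = ~⇒∈V (~-sym w~u)

  -- The independent sets are `∅`, `{a}` and `{b}`. As the right factor acts first, `t_a t_b` runs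
  -- through `∅`, `{b}`, `{a}` in this order, whence the order `b a` in `rich`.
  edge-rich : ∀ {a b} → a ~ b → (∀ {f} → f ∈ V → f ≡ a ⊎ f ≡ b) → Rich G
  edge-rich {a} {b} a~b only = rich connected b a (~-sym a~b)
    ( toggle (IS G) (a , a∈V) ∙ toggle (IS G) (b , b∈V)
    , product (generator (a , a∈V)) (generator (b , b∈V))
    , record
      { x≢y = singleton≢empty b∈V
      ; y≢z = λ eq → ~-irrefl (sym (singleton-injective b∈V a∈V eq)) a~b
      ; z≢x = ≢-sym (singleton≢empty a∈V)
      ; x↦y = toggle-fixed G (singleton G b) (⇐ (∈singleton G b∈V b) refl) a~b
      ; y↦z = cong t (toggleMap-involutive (IS G) b (empty G))
      ; z↦x = trans (cong t (toggle-fixed G (singleton G a) (⇐ (∈singleton G a∈V a) refl) (~-sym a~b)))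
                    (toggleMap-involutive (IS G) a (empty G))
      ; fixes = λ x x≢∅ x≢b x≢a →
          contradiction (Empty⇒≡empty G x λ (e , e∈x) → neither x x≢a x≢b e∈x (only (∈V G x e∈x))) x≢∅
      })
    where
    open Group (𝔖 (Member (IS G))) using (_∙_)
    t = toggleMap (IS G) a
    a∈V = ~⇒∈V a~b
    b∈V = ~⇒∈V (~-sym a~b)
    is-singleton : ∀ {e} x → e ∈ V → e ∈ value x → (∀ {f} → f ∈ value x → f ≡ e) → x ≡ singleton G e
    is-singleton {e} x e∈V e∈x unique = Member-ext {F = IS G} λ f → mk⇔
      (⇐ (∈singleton G e∈V f) ∘ unique)
      (λ f∈ → subst (_∈ value x) (sym (⇒ (∈singleton G e∈V f) f∈)) e∈x)
    neither : ∀ x → x ≢ singleton G a → x ≢ singleton G b →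
              ∀ {e} → e ∈ value x → ¬ (e ≡ a ⊎ e ≡ b)
    neither x x≢a _ a∈x (inj₁ refl) = x≢a (is-singleton x a∈V a∈x λ f∈x →
      [ id , (λ { refl → contradiction a~b (proj₂ (independent G x) a b a∈x f∈x) }) ]′
        (only (∈V G x f∈x)))
    neither x _ x≢b b∈x (inj₂ refl) = x≢b (is-singleton x b∈V b∈x λ f∈x →
      [ (λ { refl → contradiction a~b (proj₂ (independent G x) a b f∈x b∈x) }) , id ]′
        (only (∈V G x f∈x)))
    connected : Connected G
    connected {u} {v} u∈V v∈V with only u∈V | only v∈V
    ... | inj₁ refl | inj₁ refl = ε⋆
    ... | inj₁ refl | inj₂ refl = a~b ◅ ε⋆
    ... | inj₂ refl | inj₁ refl = ~-sym a~b ◅ ε⋆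
    ... | inj₂ refl | inj₂ refl = ε⋆

module _ (G : Graph n) where
  open Graph G

  star-within : ∀ {U W} → U ⊆ W → ∀ {u v} →
                Star (Graph._~_ (induced G U)) u v → Star (Graph._~_ (induced G W)) u v
  star-within U⊆W = Star.map λ (u∈U , v∈U , u~v) → U⊆W u∈U , U⊆W v∈U , u~v

  -- The cycle is first moved to `w` by `rich-at`. The only vertex that can be new is `v`, a
  -- neighbour of `w`, which is what `lift-3cycle` asks of the vertices outside `U`.
  rich-step : ∀ {U v w} → Rich (induced G U) → w ∈ U → v ~ w → Rich (induced G (U ∪ ⁅ v ⁆))
  rich-step {U} {v} {w} r@(rich connected _ _ _ _) w∈U v~w =
    rich connected′ w (proj₁ w-edge) (extend (proj₁ (proj₂ w-edge)))
      (lift-3cycle (induced-⊆-restriction G U⊆W) (proj₁ (proj₂ w-edge)) outside (proj₂ (proj₂ w-edge)))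
    where
    W = U ∪ ⁅ v ⁆
    U⊆W : U ⊆ W
    U⊆W = x∈p∪q⁺ ∘ inj₁
    v∈W : v ∈ W
    v∈W = x∈p∪q⁺ (inj₂ (x∈⁅x⁆ v))
    w∈V∩U : w ∈ V ∩ U
    w∈V∩U = x∈p∩q⁺ (~⇒∈V (~-sym v~w) , w∈U)
    w-edge = rich-at (induced G U) r w∈V∩U
    extend : ∀ {a b} → Graph._~_ (induced G U) a b → Graph._~_ (induced G W) a b
    extend (a∈U , b∈U , a~b) = U⊆W a∈U , U⊆W b∈U , a~b
    old-or-new : ∀ {f} → f ∈ W → f ∈ U ⊎ f ≡ v
    old-or-new f∈W = [ inj₁ , inj₂ ∘ x∈⁅y⁆⇒x≡y v ]′ (x∈p∪q⁻ U ⁅ v ⁆ f∈W)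
    outside : ∀ {f} → f ∈ V ∩ W → f ∉ U → Graph._~_ (induced G W) f w
    outside f∈ f∉U with old-or-new (proj₂ (x∈p∩q⁻ V W f∈))
    ... | inj₁ f∈U  = contradiction f∈U f∉U
    ... | inj₂ refl = v∈W , U⊆W w∈U , v~w
    from-w : ∀ {f} → f ∈ V ∩ W → Star (Graph._~_ (induced G W)) w f
    from-w f∈ with x∈p∩q⁻ V W f∈
    ... | f∈V , f∈W with old-or-new f∈W
    ...   | inj₁ f∈U  = star-within U⊆W (connected w∈V∩U (x∈p∩q⁺ (f∈V , f∈U)))
    ...   | inj₂ refl = (U⊆W w∈U , v∈W , ~-sym v~w) ◅ ε⋆
    connected′ : Connected (induced G W)
    connected′ x∈ y∈ = Star.reverse (Graph.~-sym (induced G W)) (from-w x∈) ◅◅ from-w y∈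

  rich-walk : ∀ {U u v} → Rich (induced G U) → u ∈ U → Star _~_ u v →
              ∃[ W ] U ⊆ W × v ∈ W × Rich (induced G W)
  rich-walk {U} r u∈U ε⋆ = U , id , u∈U , r
  rich-walk {U} r u∈U (_◅_ {j = v} u~v s) with v ∈? U
  ... | yes v∈U = rich-walk r v∈U s
  ... | no _    =
    let W , ⊆W , v∈W , r′ = rich-walk (rich-step r u∈U (~-sym u~v)) (x∈p∪q⁺ (inj₂ (x∈⁅x⁆ v))) s
    in  W , ⊆W ∘ x∈p∪q⁺ ∘ inj₁ , v∈W , r′

  module _ (connected : Connected G) where

    -- The base vertex `u` stays in every enlargement of `U`, so each listed vertex can be absorbed
    -- along a walk starting at `u`.
    rich-cover : ∀ {U u} → Rich (induced G U) → u ∈ U → u ∈ V → (vs : List (Fin n)) →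
                 ∃[ W ] U ⊆ W × (∀ {v} → v ∈ᴸ vs → v ∈ V → v ∈ W) × Rich (induced G W)
    rich-cover {U} r u∈U u∈V [] = U , id , (λ ()) , r
    rich-cover r u∈U u∈V (v ∷ vs) with rich-cover r u∈U u∈V vs | v ∈? V
    ... | W , U⊆W , covers , r′ | no v∉V = W , U⊆W , covers′ , r′
      where
      covers′ : ∀ {f} → f ∈ᴸ v ∷ vs → f ∈ V → f ∈ W
      covers′ (here refl) v∈V = contradiction v∈V v∉V
      covers′ (there f∈)  f∈V = covers f∈ f∈V
    ... | W , U⊆W , covers , r′ | yes v∈V with rich-walk r′ (U⊆W u∈U) (connected u∈V v∈V)
    ...   | X , W⊆X , v∈X , r″ = X , W⊆X ∘ U⊆W , covers′ , r″
      where
      covers′ : ∀ {f} → f ∈ᴸ v ∷ vs → f ∈ V → f ∈ X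
      covers′ (here refl) _   = v∈X
      covers′ (there f∈)  f∈V = W⊆X (covers f∈ f∈V)

    edge⇒3cycles : ∀ {a b} → a ~ b → ∀ {x y z} → x ≢ y → y ≢ z → z ≢ x → HasToggle3Cycle G x y z
    edge⇒3cycles {a} {b} a~b = from-cover (rich-cover
      (edge-rich (induced G W₀) (a∈ , x∈p∪q⁺ (inj₂ (x∈⁅x⁆ b)) , a~b)
        λ f∈ → Sum.map (x∈⁅y⁆⇒x≡y a) (x∈⁅y⁆⇒x≡y b) (x∈p∪q⁻ ⁅ a ⁆ ⁅ b ⁆ (proj₂ (x∈p∩q⁻ V W₀ f∈))))
      a∈ (~⇒∈V a~b) (allFin n))
      where
      W₀ = ⁅ a ⁆ ∪ ⁅ b ⁆
      a∈ : a ∈ W₀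
      a∈ = x∈p∪q⁺ (inj₁ (x∈⁅x⁆ a))
      from-cover : (∃[ W ] W₀ ⊆ W × (∀ {v} → v ∈ᴸ allFin n → v ∈ V → v ∈ W) × Rich (induced G W)) →
                   ∀ {x y z} → x ≢ y → y ≢ z → z ≢ x → HasToggle3Cycle G x y z
      from-cover (W , _ , covers , rich _ c d c~d cycle) =
        rich⇒3cycles G connected (~⇒∈V (proj₂ (proj₂ c~d)))
          -- `W` contains all of `V`, but `induced G W` is still a different record from `G`; the
          -- lift carries the cycle over, its condition on vertices outside `W` being vacuous.
          (_ , lift-3cycle (induced-restriction G W) c~d
            (λ f∈V f∉W → contradiction (covers (∈-allFin _) f∈V) f∉W) cycle)

    -- A connected graph without edges has at most one vertex, hence at most two independent sets.
    -- This makes the claim about 3-cycles vacuous when there is no edge to start from.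
    no-edge⇒no-3 : (∀ u v → ¬ u ~ v) → ∀ {x y z : Member (IS G)} → x ≢ y → y ≢ z → z ≢ x → Empty.⊥
    no-edge⇒no-3 none {x} {y} {z} x≢y y≢z z≢x =
      cases (nonempty? (value x)) (nonempty? (value y)) (nonempty? (value z))
      where
      unique : ∀ {u v} → u ∈ V → v ∈ V → u ≡ v
      unique u∈V v∈V with connected u∈V v∈V
      ... | ε⋆      = refl
      ... | u~v ◅ _ = contradiction u~v (none _ _)
      both-nonempty : ∀ x y → Nonempty (value x) → Nonempty (value y) → x ≡ y
      both-nonempty x y (e , e∈x) (f , f∈y) = Member-ext {F = IS G} λ g → mk⇔
        (λ g∈x → subst (_∈ value y) (unique (∈V G y f∈y) (∈V G x g∈x)) f∈y)
        (λ g∈y → subst (_∈ value x) (unique (∈V G x e∈x) (∈V G y g∈y)) e∈x)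
      both-empty : ∀ (x y : Member (IS G)) → ¬ Nonempty (value x) → ¬ Nonempty (value y) → x ≡ y
      both-empty x y ∄x ∄y = trans (Empty⇒≡empty G x ∄x) (sym (Empty⇒≡empty G y ∄y))
      cases : Dec (Nonempty (value x)) → Dec (Nonempty (value y)) → Dec (Nonempty (value z)) → Empty.⊥
      cases (yes p) (yes q) _       = x≢y (both-nonempty x y p q)
      cases (no p)  (no q)  _       = x≢y (both-empty x y p q)
      cases _       (yes q) (yes r) = y≢z (both-nonempty y z q r)
      cases _       (no q)  (no r)  = y≢z (both-empty y z q r)
      cases (yes p) _       (yes r) = z≢x (both-nonempty z x r p)
      cases (no p)  _       (no r)  = z≢x (both-empty z x r p)

    connected⇒alternating : ToggleAlternating (IS G)
    connected⇒alternating = even⇒generated (Member-≟ (IS G)) 3cycles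
      where
      3cycles : ∀ {x y z} → x ≢ y → y ≢ z → z ≢ x → HasToggle3Cycle G x y z
      3cycles x≢y y≢z z≢x with any? (λ u → any? (λ v → u ~? v))
      ... | yes (a , b , a~b) = edge⇒3cycles a~b x≢y y≢z z≢x
      ... | no ∄ = contradiction z≢x (no-edge⇒no-3 (λ u v u~v → ∄ (u , v , u~v)) x≢y y≢z)

-- Homomorphisms into finite products

IsHom : (G : Group a b) (H : Group c ℓ) → (Group.Carrier G → Group.Carrier H) → Set (a ⊔ b ⊔ ℓ)
IsHom G H = IsGroupHomomorphism (Group.rawGroup G) (Group.rawGroup H)

module _ (G : Group a b) where
  private module G = Group G

  tuple : {H : Fin k → Group c ℓ} → (∀ i → G.Carrier → Group.Carrier (H i)) →
          G.Carrier → Group.Carrier (∏ H)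
  tuple {k = zero}  f x = tt
  tuple {k = suc _} f x = f zero x , tuple (f ∘ suc) x

  tuple-isHom : {H : Fin k → Group c ℓ} {f : ∀ i → G.Carrier → Group.Carrier (H i)} →
                (∀ i → IsHom G (H i) (f i)) → IsHom G (∏ H) (tuple {H = H} f)
  tuple-isHom {k = zero}  _ = _
  tuple-isHom {k = suc _} {H = H} hom = record
    { isMonoidHomomorphism = record
      { isMagmaHomomorphism = record
        { isRelHomomorphism = record { cong = λ x≈y → F.⟦⟧-cong x≈y , Fs.⟦⟧-cong x≈y }
        ; homo = λ x y → F.homo x y , Fs.homo x y
        }
      ; ε-homo = F.ε-homo , Fs.ε-homo
      }
    ; ⁻¹-homo = λ x → F.⁻¹-homo x , Fs.⁻¹-homo x
    }
    where
    module F  = IsGroupHomomorphism (hom zero)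
    module Fs = IsGroupHomomorphism (tuple-isHom {H = H ∘ suc} (hom ∘ suc))

  tuple-injective : {H : Fin k → Group c ℓ} {f : ∀ i → G.Carrier → Group.Carrier (H i)}
                    {x y : G.Carrier} →
                    Group._≈_ (∏ H) (tuple {H = H} f x) (tuple {H = H} f y) →
                    ∀ i → Group._≈_ (H i) (f i x) (f i y)
  tuple-injective         (eq , _)  zero    = eq
  tuple-injective {H = H} (_ , eqs) (suc i) = tuple-injective {H = H ∘ suc} eqs i

  assemble : {H : Fin k → Group c ℓ} → (∀ i → Group.Carrier (H i) → G.Carrier) →
             Group.Carrier (∏ H) → G.Carrier
  assemble {k = zero}  s _        = G.ε
  assemble {k = suc _} s (y , ys) = s zero y G.∙ assemble (s ∘ suc) ys

  assemble-killed : {H : Fin k → Group c ℓ} {s : ∀ i → Group.Carrier (H i) → G.Carrier}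
                    (K : Group c ℓ) {f : G.Carrier → Group.Carrier K} → IsHom G K f →
                    (∀ i y → Group._≈_ K (f (s i y)) (Group.ε K)) →
                    ∀ ys → Group._≈_ K (f (assemble {H = H} s ys)) (Group.ε K)
  assemble-killed {k = zero}  K hom kills _ = IsGroupHomomorphism.ε-homo hom
  assemble-killed {k = suc _} {H = H} {s} K {f} hom kills (y , ys) = begin
    f (s zero y G.∙ assemble (s ∘ suc) ys)
      ≈⟨ homo _ _ ⟩
    f (s zero y) K.∙ f (assemble (s ∘ suc) ys)
      ≈⟨ K.∙-cong (kills zero y) (assemble-killed {H = H ∘ suc} K hom (kills ∘ suc) ys) ⟩
    K.ε K.∙ K.ε
      ≈⟨ K.identityˡ K.ε ⟩
    K.ε ∎
    where
    module K = Group K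
    open IsGroupHomomorphism hom using (homo)
    open import Relation.Binary.Reasoning.Setoid K.setoid

  -- In each coordinate all factors die but the one belonging to it, and that one gives back its
  -- entry.
  tuple-assemble : {H : Fin k → Group c ℓ} {f : ∀ i → G.Carrier → Group.Carrier (H i)}
                   {s : ∀ i → Group.Carrier (H i) → G.Carrier} →
                   (∀ i → IsHom G (H i) (f i)) →
                   (∀ i y → Group._≈_ (H i) (f i (s i y)) y) →
                   (∀ {i j} → i ≢ j → ∀ y → Group._≈_ (H j) (f j (s i y)) (Group.ε (H j))) →
                   ∀ ys → Group._≈_ (∏ H) (tuple {H = H} f (assemble {H = H} s ys)) ys
  tuple-assemble {k = zero}  _ _ _ _ = _
  tuple-assemble {k = suc _} {H = H} {f} {s} hom section disjoint (y , ys) = head , tail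
    where
    module K = Group (H zero)
    head : f zero (s zero y G.∙ assemble (s ∘ suc) ys) K.≈ y
    head = begin
      f zero (s zero y G.∙ assemble (s ∘ suc) ys)
        ≈⟨ IsGroupHomomorphism.homo (hom zero) _ _ ⟩
      f zero (s zero y) K.∙ f zero (assemble (s ∘ suc) ys)
        ≈⟨ K.∙-cong (section zero y)
          (assemble-killed {H = H ∘ suc} (H zero) (hom zero) (λ i → disjoint λ ()) ys) ⟩
      y K.∙ K.ε
        ≈⟨ K.identityʳ y ⟩
      y ∎
      where open import Relation.Binary.Reasoning.Setoid K.setoid
    module Ks = Group (∏ (H ∘ suc))
    tuple-kills : ∀ {m} {H′ : Fin m → Group _ _} {f′ : ∀ i → G.Carrier → Group.Carrier (H′ i)} {x} →
                  (∀ i → Group._≈_ (H′ i) (f′ i x) (Group.ε (H′ i))) →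
                  Group._≈_ (∏ H′) (tuple {H = H′} f′ x) (Group.ε (∏ H′))
    tuple-kills {m = zero}  _ = _
    tuple-kills {m = suc _} {H′} eq = eq zero , tuple-kills {H′ = H′ ∘ suc} (eq ∘ suc)
    tail : tuple (f ∘ suc) (s zero y G.∙ assemble (s ∘ suc) ys) Ks.≈ ys
    tail = begin
      tuple (f ∘ suc) (s zero y G.∙ assemble (s ∘ suc) ys)
        ≈⟨ IsGroupHomomorphism.homo (tuple-isHom {H = H ∘ suc} (hom ∘ suc)) _ _ ⟩
      tuple (f ∘ suc) (s zero y) Ks.∙ tuple (f ∘ suc) (assemble (s ∘ suc) ys)
        ≈⟨ Ks.∙-cong (tuple-kills {H′ = H ∘ suc} (λ i → disjoint (λ ()) y))
          (tuple-assemble {H = H ∘ suc} (hom ∘ suc) (section ∘ suc)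
            (λ i≢j → disjoint (i≢j ∘ suc-injective)) ys) ⟩
      Ks.ε Ks.∙ ys
        ≈⟨ Ks.identityˡ ys ⟩
      ys ∎
      where open import Relation.Binary.Reasoning.Setoid Ks.setoid

  ≅∏ : (H : Fin k → Group c ℓ) (f : ∀ i → G.Carrier → Group.Carrier (H i))
       (s : ∀ i → Group.Carrier (H i) → G.Carrier) →
       (∀ i → IsHom G (H i) (f i)) →
       (∀ x y → (∀ i → Group._≈_ (H i) (f i x) (f i y)) → x G.≈ y) →
       (∀ i y → Group._≈_ (H i) (f i (s i y)) y) →
       (∀ {i j} → i ≢ j → ∀ y → Group._≈_ (H j) (f j (s i y)) (Group.ε (H j))) →
       G ≅ ∏ H
  ≅∏ H f s hom injective section disjoint = tuple {H = H} f , record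
    { isGroupMonomorphism = record
      { isGroupHomomorphism = hom′
      ; injective = injective _ _ ∘ tuple-injective {H = H}
      }
    ; surjective = λ ys → assemble {H = H} s ys , λ z≈ →
        Group.trans (∏ H) (IsGroupHomomorphism.⟦⟧-cong hom′ z≈)
          (tuple-assemble {H = H} hom section disjoint ys)
    }
    where hom′ = tuple-isHom {H = H} hom

-- Decomposition into components

module _ {G H : Graph n} {U : Subset n} (H≤G : H IsRestrictionOf G To U) where

  lifting : Group.Carrier (ToggleGroup (IS H)) → Group.Carrier (ToggleGroup (IS G))
  lifting (_ , p) = let ρ , q , _ = lift H≤G p in ρ , q

  lifting-lifts : ∀ σ → Lifts H≤G (to (proj₁ σ)) (to (proj₁ (lifting σ)))
  lifting-lifts (_ , p) = proj₁ (proj₂ (proj₂ (lift H≤G p)))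

module _ {G H : Graph n} {U : Subset n} (H≤G : H IsRestrictionOf G To U)
         (closed : ∀ {u v} → u ∈ U → Graph._~_ G u v → v ∈ U) where
  private
    module G = Graph G
    module H = Graph H

    -- A toggle outside `U` projects to the identity: it leaves the part in `U` alone, and since no
    -- edge leaves `U`, every set is detached.
    toggle-project : ∀ {e} (e∈V : e ∈ G.V) → ∃[ ρ ] ⟨toggles⟩ H ρ ×
      (∀ {x′ x} → TraceOf H≤G x′ x → TraceOf H≤G (toggleMap (IS G) e x′) (to ρ x)) ×
      (∀ {x′ x} → TraceOf H≤G x′ x → TraceOf H≤G (toggleMap (IS G) e x′) (from ρ x))
    toggle-project {e} e∈V with e ∈? U
    ... | yes e∈U = _ , generator (e , ⇐ (∈V⇔ H≤G) (e∈V , e∈U)) ,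
      trace-toggle H≤G e∈U , trace-toggle H≤G e∈U
    ... | no e∉U  = _ , identity , unchanged , unchanged
      where
      unchanged : ∀ {x′ x} → TraceOf H≤G x′ x → TraceOf H≤G (toggleMap (IS G) e x′) x
      unchanged {x′} r = record
        { agree    = λ f∈U → ⇔-trans (toggle-∈-≢ (IS G) e x′ λ f≡e →
            e∉U (subst (_∈ U) f≡e f∈U)) (TraceOf.agree r f∈U)
        ; detached = λ _ f∉U u∈U u~f → f∉U (closed u∈U u~f)
        }

  trace-restrict : ∀ x′ → TraceOf H≤G x′ (restrict H≤G x′)
  trace-restrict x′ = record
    { agree    = restrict-agree H≤G x′
    ; detached = λ _ f∉U u∈U u~f → f∉U (closed u∈U u~f)
    }

  project : ∀ {π} → ⟨toggles⟩ G π → ∃[ ρ ] ⟨toggles⟩ H ρ ×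
            (∀ {x′ x} → TraceOf H≤G x′ x → TraceOf H≤G (to π x′) (to ρ x)) ×
            (∀ {x′ x} → TraceOf H≤G x′ x → TraceOf H≤G (from π x′) (from ρ x))
  project = transfer (toggle (IS G)) (toggle (IS H))
    (λ f g → ∀ {x′ x} → TraceOf H≤G x′ x → TraceOf H≤G (f x′) (g x))
    id (λ p q r → p (q r))
    (λ {f} {f′} {g} f≗f′ p {x′} {x} r → subst (λ y → TraceOf H≤G y (g x)) (f≗f′ x′) (p r))
    (λ (e , e∈V) → toggle-project e∈V)

  private
    module TG = Group (ToggleGroup (IS G))
    module TH = Group (ToggleGroup (IS H))

  projection : TG.Carrier → TH.Carrier
  projection (_ , p) = let ρ , q , _ = project p in ρ , q

  projection-trace : ∀ π {x′ x} → TraceOf H≤G x′ x →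
                     TraceOf H≤G (to (proj₁ π) x′) (to (proj₁ (projection π)) x)
  projection-trace (_ , p) = proj₁ (proj₂ (proj₂ (project p)))

  -- The projection is computed from the derivation, so products and inverses are respected by
  -- computation. What needs an argument is independence of the derivation: the image of `x` is the
  -- trace of the image of `embed x`, which depends on the permutation alone.
  projection-isHom : IsHom (ToggleGroup (IS G)) (ToggleGroup (IS H)) projection
  projection-isHom = record
    { isMonoidHomomorphism = record
      { isMagmaHomomorphism = record
        { isRelHomomorphism = record { cong = λ {π} {ρ} π≈ρ x →
            trace-unique H≤G (projection-trace π (trace-embed H≤G x))
              (subst (λ y → TraceOf H≤G y _) (sym (π≈ρ _)) (projection-trace ρ (trace-embed H≤G x))) }
        ; homo = λ _ _ _ → refl
        }
      ; ε-homo = λ _ → refl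
      }
    ; ⁻¹-homo = λ _ _ → refl
    }

  -- Both sides describe the trace of the lifted permutation applied to `embed x`, and traces are
  -- unique.
  projection-lifting : ∀ σ → projection (lifting H≤G σ) TH.≈ σ
  projection-lifting σ x =
    trace-unique H≤G (projection-trace (lifting H≤G σ) r) (Lifts.trace-lift (lifting-lifts H≤G σ) r)
    where r = trace-embed H≤G x

module _ (G : Graph n) (C : Fin k → Subset n) (comps : AreComponents G C) where
  open Graph G

  component-closed : ∀ i {u v} → u ∈ C i → u ~ v → v ∈ C i
  component-closed i {u} {v} u∈C u~v with proj₁ comps i
  ... | _ , _ , ∈C⇔ = ⇐ (∈C⇔ v) (⇒ (∈C⇔ u) u∈C ◅◅ (u~v ◅ ε⋆))

  components-⊆ : ∀ {i j v} → v ∈ C i → v ∈ C j → C i ⊆ C j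
  components-⊆ {i} {j} {v} v∈Ci v∈Cj {w} w∈Ci with proj₁ comps i | proj₁ comps j
  ... | _ , _ , ∈Ci⇔ | _ , _ , ∈Cj⇔ =
    ⇐ (∈Cj⇔ w) (⇒ (∈Cj⇔ v) v∈Cj ◅◅ Star.reverse ~-sym (⇒ (∈Ci⇔ v) v∈Ci) ◅◅ ⇒ (∈Ci⇔ w) w∈Ci)

  components-disjoint : ∀ {i j v} → v ∈ C i → v ∈ C j → i ≡ j
  components-disjoint v∈Ci v∈Cj =
    proj₁ (proj₂ comps) (⊆-antisym (components-⊆ v∈Ci v∈Cj) (components-⊆ v∈Cj v∈Ci))

  toggleGroup≅∏ : ToggleGroup (IS G) ≅ ∏ (λ i → ToggleGroup (IS (induced G (C i))))
  toggleGroup≅∏ = ≅∏ TG TH φᵢ ψᵢ (λ i → projection-isHom (r i) (component-closed i))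
    injective (λ i → projection-lifting (r i) (component-closed i)) disjoint
    where
    TG = ToggleGroup (IS G)
    TH : Fin k → Group _ _
    TH i = ToggleGroup (IS (induced G (C i)))
    r : ∀ i → (induced G (C i)) IsRestrictionOf G To (C i)
    r i = induced-restriction G (C i)
    φᵢ : ∀ i → Group.Carrier TG → Group.Carrier (TH i)
    φᵢ i = projection (r i) (component-closed i)
    ψᵢ : ∀ i → Group.Carrier (TH i) → Group.Carrier TG
    ψᵢ i = lifting (r i)
    -- Each vertex of `π x` lies in some `C i`, and there `π x` and `ρ x` have the same trace
    -- because the `i`-th projections agree.
    ⊆-via : ∀ π ρ → (∀ i → Group._≈_ (TH i) (φᵢ i π) (φᵢ i ρ)) →
            ∀ x → value (to (proj₁ π) x) ⊆ value (to (proj₁ ρ) x)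
    ⊆-via π ρ eq x {f} f∈πx with proj₂ (proj₂ comps) (∈V G (to (proj₁ π) x) f∈πx)
    ... | i , f∈C = ⇐ (TraceOf.agree (projection-trace (r i) (component-closed i) ρ tr) f∈C)
      (subst (λ y → f ∈ value y) (eq i _)
        (⇒ (TraceOf.agree (projection-trace (r i) (component-closed i) π tr) f∈C) f∈πx))
      where tr = trace-restrict (r i) (component-closed i) x
    injective : ∀ π ρ → (∀ i → Group._≈_ (TH i) (φᵢ i π) (φᵢ i ρ)) → Group._≈_ TG π ρ
    injective π ρ eq x = Member-ext {F = IS G} λ f →
      mk⇔ (⊆-via π ρ eq x) (⊆-via ρ π (λ i y → sym (eq i y)) x)
    -- A permutation lifted from `C i` changes nothing outside `C i`, in particular nothing in
    -- `C j`, so `x` is still the trace on `C j`.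
    disjoint : ∀ {i j} → i ≢ j → ∀ σ → Group._≈_ (TH j) (φᵢ j (ψᵢ i σ)) (Group.ε (TH j))
    disjoint {i} {j} i≢j σ x = trace-unique (r j)
      (projection-trace (r j) (component-closed j) (ψᵢ i σ) (trace-embed (r j) x)) (record
      { agree    = λ f∈Cj → Lifts.outside-fixed (lifting-lifts (r i) σ) (embed (r j) x)
          (λ f∈Ci → i≢j (components-disjoint f∈Ci f∈Cj))
      ; detached = λ _ f∉ u∈ u~f → f∉ (component-closed j u∈ u~f)
      })

corollary3p24 : ∀ {n : ℕ} (G : Graph n) →
    (Connected G → ToggleAlternating (IS G)) ×
    (∀ {k : ℕ} (C : Fin k → Subset n) → AreComponents G C →
    ToggleGroup (IS G) ≅ ∏ (λ i → ToggleGroup (IS (induced G (C i)))))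
corollary3p24 G = connected⇒alternating G , toggleGroup≅∏ G
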